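{- If $\pi_1,\pi_2,\pi_3,\pi_4$ are $4$-point permutations such that $A_{\pi_1}+A_{\pi_2}-A_{\pi_3}-A_{\pi_4}$ is the zero matrix, then $\{\pi_1,\pi_2,\pi_3,\pi_4\}$ is not quasirandom-forcing.
   Context: $A_\pi$ is the $4\times4$ permutation matrix of $\pi$: entry $1$ in row $i$ and column $\pi(i)$, $0$ elsewhere. Pattern density $d(\sigma,\pi)$: probability that a uniformly random $|\sigma|$-subset of positions of $\pi$ induces the pattern $\sigma$. A set $S$ of permutations is quasirandom-forcing if every sequence of permutations with sizes tending to infinity and $d(\sigma,\pi_n)\to1/|\sigma|!$ for all $\sigma\in S$ has $d(\sigma,\pi_n)\to1/|\sigma|!$ for all permutations $\sigma$. -}

module Defs where

open import Data.Nat as ℕ using (ℕ; zero; suc; _≤_; _<ᵇ_)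
open import Data.Nat.Base using (_!)
open import Data.Nat.Properties using (_!≢0)
open import Data.Bool.ListAction using (and)
open import Data.Integer as ℤ using (ℤ; +_)
open import Data.Rational as ℚ using (ℚ; 0ℚ; 1ℚ; _<_; ∣_∣; _-_)
open import Data.Fin using (Fin; zero; suc; toℕ)
open import Data.Fin.Permutation using (Permutation′; _⟨$⟩ʳ_)
open import Data.Vec as Vec using (Vec; []; _∷_)
open import Data.List as List using (List; []; _∷_; _++_; length; filter; allFin)
open import Data.List.Relation.Unary.All using (All)
open import Data.Bool using (Bool; true; false; if_then_else_)
open import Data.Product using (Σ; ∃; _,_; _×_)
open import Relation.Binary.PropositionalEquality using (_≡_)
open import Relation.Unary using (Pred)
open import Relation.Nullary using (¬_)
open import Level using (0ℓ)

Perm : ℕ → Set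
Perm n = Permutation′ n

permMatrix : ∀ {n} → Perm n → Fin n → Fin n → ℤ
permMatrix π i j with toℕ (π ⟨$⟩ʳ i) ℕ.≡ᵇ toℕ j
... | true  = + 1
... | false = + 0

-- All k-subsets of the positions {0,…,n-1}, each listed as a strictly
-- increasing vector of its elements.
subsets : (n k : ℕ) → List (Vec (Fin n) k)
subsets n       zero    = [] ∷ []
subsets zero    (suc k) = []
subsets (suc n) (suc k) =
  List.map (λ v → zero ∷ Vec.map suc v) (subsets n k)
  ++ List.map (Vec.map suc) (subsets n (suc k))

boolEq : Bool → Bool → Bool
boolEq true  b = b
boolEq false b = if b then false else true

-- The positions f(0) < … < f(k-1) of π induce the pattern σ.
induces : ∀ {k n} → Perm k → Perm n → Vec (Fin n) k → Bool
induces {k} σ π f =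
  and (List.map (λ i → and (List.map (λ j →
        boolEq (toℕ (π ⟨$⟩ʳ Vec.lookup f i) <ᵇ toℕ (π ⟨$⟩ʳ Vec.lookup f j))
               (toℕ (σ ⟨$⟩ʳ i) <ᵇ toℕ (σ ⟨$⟩ʳ j)))
      (allFin k))) (allFin k))

occurrences : ∀ {k n} → Perm k → Perm n → ℕ
occurrences {k} {n} σ π = length (filter (λ f → induces σ π f ≡? true) (subsets n k))
  where
  open import Data.Bool.Properties using () renaming (_≟_ to _≡?_)

-- Pattern density d(σ,π): probability that a uniformly random |σ|-subset
-- of positions of π induces σ (taken to be 0 when |σ| > |π|).
density : ∀ {k n} → Perm k → Perm n → ℚ
density {k} {n} σ π with length (subsets n k)
... | zero  = 0ℚ
... | suc c = + occurrences σ π ℚ./ suc c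

invFact : ℕ → ℚ
invFact k = (+ 1) ℚ./ (k !)
  where instance _ = k !≢0

ConvergesTo : (ℕ → ℚ) → ℚ → Set
ConvergesTo a L = ∀ (ε : ℚ) → 0ℚ < ε → ∃ λ N → ∀ m → N ≤ m → ∣ a m - L ∣ < ε

TendsToInfinity : (ℕ → ℕ) → Set
TendsToInfinity s = ∀ B → ∃ λ N → ∀ m → N ≤ m → B ≤ s m

AnyPerm : Set
AnyPerm = Σ ℕ Perm

DensityQuasirandom : (s : ℕ → ℕ) → ((m : ℕ) → Perm (s m)) → AnyPerm → Set
DensityQuasirandom s πs (k , σ) = ConvergesTo (λ m → density σ (πs m)) (invFact k)

QuasirandomForcing : List AnyPerm → Set
QuasirandomForcing S =
  ∀ (s : ℕ → ℕ) (πs : (m : ℕ) → Perm (s m)) →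
  TendsToInfinity s →
  All (DensityQuasirandom s πs) S →
  ∀ (σ : AnyPerm) → DensityQuasirandom s πs σ

{-# OPTIONS --safe #-}
module Submission where

-- Replace every entry of a permutation τ of size n by a monotone run of length m,
-- increasing or decreasing as prescribed for that entry.  As m → ∞, the density of a
-- pattern σ of length k tends to W(σ) / nᵏ, where W(σ) counts the k-multisets of entries
-- whose runs realise σ, weighted by multinomial coefficients.  So it is enough to find
-- τ and orientations with 24 W(πᵢ) = n⁴ for the four given patterns and 6 W(123) ≠ n³.
-- The matrix condition says that {π₁ i, π₂ i} = {π₃ i, π₄ i} as multisets for every
-- position i, which leaves finitely many cases; 32 choices of τ of size 12 settle them all.

open import Defs
open import Data.Bool.Base using (Bool; true; false; if_then_else_; _∧_; not; T)
open import Data.Bool.ListAction using (and)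
open import Data.Bool.Properties using () renaming (_≟_ to _≟ᵇ_)
open import Data.Fin.Base as Fin using (Fin; zero; suc; toℕ; combine; quotient; remQuot; opposite; _↑ˡ_; _↑ʳ_)
open import Data.Fin.Permutation using (permutation; id; _⟨$⟩ʳ_; _⟨$⟩ˡ_; inverseˡ; inverseʳ)
open import Data.Fin.Properties as Fin using (_≟_; all?; any?)
open import Data.Integer as ℤ using (ℤ; +_; +[1+_]; _⊖_)
import Data.Integer.Properties as ℤ
open import Data.List.Base as List using (List; []; _∷_; _++_; replicate; length; filter; tabulate; allFin)
import Data.List.Properties as List
open import Data.List.Membership.Propositional using (_∈_)
open import Data.List.Relation.Unary.All as All using (All; []; _∷_)
open import Data.List.Relation.Unary.Any as Any using (Any; here; there)
open import Data.Nat.Base as ℕ hiding (_+_; _/_; _%_)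
open import Data.Nat.Combinatorics using (_C_; nCk+nC[k+1]≡[n+1]C[k+1])
open import Data.Nat.DivMod using (_/_; _%_; _mod_)
open import Data.Nat.ListAction using (sum)
open import Data.Nat.ListAction.Properties using (sum-++)
import Data.Nat.Properties as ℕ
open import Data.List.Membership.DecPropositional ℕ._≟_ using (_∈?_)
open import Data.Nat.Solver using (module +-*-Solver)
open import Data.Product.Base using (_×_; _,_; proj₁; proj₂; uncurry; ∃)
open import Data.Rational.Base as ℚ using (ℚ; mkℚ; 0ℚ; toℚᵘ; *<*)
import Data.Rational.Properties as ℚ
open import Algebra.Properties.Group ℚ.+-0-group using (x∙y⁻¹≈ε⇒x≈y)
open import Data.Rational.Solver using () renaming (module +-*-Solver to ℚ-Solver)
open import Data.Rational.Unnormalised.Base as ℚᵘ using (mkℚᵘ; *≡*)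
import Data.Rational.Unnormalised.Properties as ℚᵘ
open import Data.Sum.Base using (inj₁; inj₂)
open import Data.Vec.Base as Vec using (Vec; []; _∷_; lookup; toList)
import Data.Vec.Properties as Vec
open import Data.Vec.Relation.Unary.AllPairs using (allPairs?)
open import Data.Vec.Relation.Unary.Unique.Propositional using (Unique)
open import Data.Vec.Relation.Unary.Unique.Propositional.Properties using (tabulate⁺)
open import Function.Base using (_∘_; const)
open import Relation.Binary.Definitions using (tri<; tri≈; tri>)
open import Relation.Binary.PropositionalEquality
open import Relation.Nullary using (¬_; Dec; contradiction; yes; no)
open import Relation.Nullary.Decidable using (map′; toWitness; _×-dec_; _→-dec_; ¬?)
open import Relation.Unary using (Decidable)

-- Densities in inflations

-- For large `m`, `k` random points of the inflation fall into nearly independent uniform entries of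
-- τ. A multiset of entries with multiplicities mᵢ arises from k!/∏ mᵢ! words, and points sharing an
-- entry lie on one monotone run, so their pattern is fixed by its orientation. This gives the limit
-- W(σ)/nᵏ as an exact rational, with no random construction. At finite `m` the count is not exact;
-- it is squeezed between multiples of (m - k)ᵏ and mᵏ, whose ratio tends to 1. Forcing fails as
-- soon as a single pattern has a wrong limit, and 123 is a convenient witness. Exact balance
-- restricts the size: 24 W = n⁴ makes 24 divide n⁴, so n is a multiple of 6, as 12 is. The case
-- analysis also contains the degenerate cases where π₃ and π₄ repeat π₁ and π₂, so any two patterns
-- of length 4 have to be balanced by a common design.

module Inflation where

  open import Data.Nat.Base using (_+_)
  open import Data.Nat.Properties hiding (_≟_)

  private variable
    A : Set
    k n m : ℕ

  -- Finite sums and bounds on falling factorials.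

  Σ≤ : ℕ → (ℕ → ℕ) → ℕ
  Σ≤ zero    f = f 0
  Σ≤ (suc n) f = f 0 + Σ≤ n (f ∘ suc)

  Σ≤-cong : ∀ n {f g} → (∀ i → i ≤ n → f i ≡ g i) → Σ≤ n f ≡ Σ≤ n g
  Σ≤-cong zero    f≡g = f≡g 0 z≤n
  Σ≤-cong (suc n) f≡g = cong₂ _+_ (f≡g 0 z≤n) (Σ≤-cong n (λ i i≤n → f≡g (suc i) (s≤s i≤n)))

  Σ≤-mono : ∀ n {f g} → (∀ i → i ≤ n → f i ≤ g i) → Σ≤ n f ≤ Σ≤ n g
  Σ≤-mono zero    f≤g = f≤g 0 z≤n
  Σ≤-mono (suc n) f≤g = +-mono-≤ (f≤g 0 z≤n) (Σ≤-mono n (λ i i≤n → f≤g (suc i) (s≤s i≤n)))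

  Σ≤-zero : ∀ n → Σ≤ n (λ _ → 0) ≡ 0
  Σ≤-zero zero    = refl
  Σ≤-zero (suc n) = Σ≤-zero n

  Σ≤-+ : ∀ n f g → Σ≤ n (λ i → f i + g i) ≡ Σ≤ n f + Σ≤ n g
  Σ≤-+ zero    f g = refl
  Σ≤-+ (suc n) f g = trans (cong (_+_ (f 0 + g 0)) (Σ≤-+ n (f ∘ suc) (g ∘ suc)))
    (solve 4 (λ a b c d → a :+ b :+ (c :+ d) := a :+ c :+ (b :+ d)) refl
      (f 0) (g 0) (Σ≤ n (f ∘ suc)) (Σ≤ n (g ∘ suc)))
    where open +-*-Solver

  *-distribˡ-Σ≤ : ∀ c n f → c * Σ≤ n f ≡ Σ≤ n (λ i → c * f i)
  *-distribˡ-Σ≤ c zero    f = refl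
  *-distribˡ-Σ≤ c (suc n) f = trans (*-distribˡ-+ c (f 0) _) (cong (_+_ (c * f 0)) (*-distribˡ-Σ≤ c n (f ∘ suc)))

  [k+1]*[n+1]C[k+1]≡[n+1]*nCk : ∀ n k → suc k * (suc n C suc k) ≡ suc n * (n C k)
  [k+1]*[n+1]C[k+1]≡[n+1]*nCk zero    zero    = refl
  [k+1]*[n+1]C[k+1]≡[n+1]*nCk zero    (suc k) = *-zeroʳ (suc (suc k))
  [k+1]*[n+1]C[k+1]≡[n+1]*nCk (suc n) zero    = begin
    1 * (suc (suc n) C 1)                  ≡⟨ cong (1 *_) (nCk+nC[k+1]≡[n+1]C[k+1] (suc n) 0) ⟨
    1 * (1 + (suc n C 1))                  ≡⟨ *-distribˡ-+ 1 1 (suc n C 1) ⟩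
    1 + 1 * (suc n C 1)                    ≡⟨ cong suc ([k+1]*[n+1]C[k+1]≡[n+1]*nCk n 0) ⟩
    suc (suc n * 1)                        ∎
    where open ≡-Reasoning
  [k+1]*[n+1]C[k+1]≡[n+1]*nCk (suc n) (suc k) = begin
    suc (suc k) * (suc (suc n) C suc (suc k))
      ≡⟨ cong (suc (suc k) *_) (nCk+nC[k+1]≡[n+1]C[k+1] (suc n) (suc k)) ⟨
    suc (suc k) * ((suc n C suc k) + (suc n C suc (suc k)))
      ≡⟨ solve 3 (λ k a b → (con 2 :+ k) :* (a :+ b) := a :+ (con 1 :+ k) :* a :+ (con 2 :+ k) :* b) refl
           k (suc n C suc k) (suc n C suc (suc k)) ⟩
    (suc n C suc k) + suc k * (suc n C suc k) + suc (suc k) * (suc n C suc (suc k))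
      ≡⟨ cong₂ (λ x y → (suc n C suc k) + x + y)
           ([k+1]*[n+1]C[k+1]≡[n+1]*nCk n k) ([k+1]*[n+1]C[k+1]≡[n+1]*nCk n (suc k)) ⟩
    (suc n C suc k) + suc n * (n C k) + suc n * (n C suc k)
      ≡⟨ solve 4 (λ a n b c → a :+ n :* b :+ n :* c := a :+ n :* (b :+ c)) refl
           (suc n C suc k) (suc n) (n C k) (n C suc k) ⟩
    (suc n C suc k) + suc n * ((n C k) + (n C suc k))
      ≡⟨ cong (λ x → (suc n C suc k) + suc n * x) (nCk+nC[k+1]≡[n+1]C[k+1] n k) ⟩
    suc (suc n) * (suc n C suc k) ∎
    where
    open ≡-Reasoning
    open +-*-Solver

  [i+k]Ci*i!*k!≡[i+k]! : ∀ i k → ((i + k) C i) * (i ! * k !) ≡ (i + k) !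
  [i+k]Ci*i!*k!≡[i+k]! zero    k = trans (*-identityˡ _) (*-identityˡ _)
  [i+k]Ci*i!*k!≡[i+k]! (suc i) k = begin
    (suc (i + k) C suc i) * (suc i * i ! * k !)
      ≡⟨ solve 4 (λ c s a b → c :* (s :* a :* b) := s :* c :* (a :* b)) refl
           (suc (i + k) C suc i) (suc i) (i !) (k !) ⟩
    suc i * (suc (i + k) C suc i) * (i ! * k !)
      ≡⟨ cong (_* (i ! * k !)) ([k+1]*[n+1]C[k+1]≡[n+1]*nCk (i + k) i) ⟩
    suc (i + k) * ((i + k) C i) * (i ! * k !)
      ≡⟨ *-assoc (suc (i + k)) ((i + k) C i) (i ! * k !) ⟩
    suc (i + k) * (((i + k) C i) * (i ! * k !))
      ≡⟨ cong (suc (i + k) *_) ([i+k]Ci*i!*k!≡[i+k]! i k) ⟩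
    suc (i + k) ! ∎
    where
    open ≡-Reasoning
    open +-*-Solver

  -- The product `i ! * (m C i)` is the falling factorial m(m-1)...(m-i+1); this is its recursion,
  -- by which the two bounds below follow factor by factor.
  [i+1]!*[m+1]C[i+1]≡[m+1]*i!*mCi : ∀ m i → suc i ! * (suc m C suc i) ≡ suc m * (i ! * (m C i))
  [i+1]!*[m+1]C[i+1]≡[m+1]*i!*mCi m i = begin
    suc i * i ! * (suc m C suc i)     ≡⟨ solve 3 (λ s a c → s :* a :* c := a :* (s :* c)) refl (suc i) (i !) _ ⟩
    i ! * (suc i * (suc m C suc i))   ≡⟨ cong (i ! *_) ([k+1]*[n+1]C[k+1]≡[n+1]*nCk m i) ⟩
    i ! * (suc m * (m C i))           ≡⟨ solve 3 (λ a m c → a :* (m :* c) := m :* (a :* c)) refl (i !) (suc m) (m C i) ⟩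
    suc m * (i ! * (m C i))           ∎
    where
    open ≡-Reasoning
    open +-*-Solver

  i!*mCi≤m^i : ∀ m i → i ! * (m C i) ≤ m ^ i
  i!*mCi≤m^i m       zero    = ≤-refl
  i!*mCi≤m^i zero    (suc i) = ≤-reflexive (*-zeroʳ (suc i !))
  i!*mCi≤m^i (suc m) (suc i) = begin
    suc i ! * (suc m C suc i)   ≡⟨ [i+1]!*[m+1]C[i+1]≡[m+1]*i!*mCi m i ⟩
    suc m * (i ! * (m C i))     ≤⟨ *-monoʳ-≤ (suc m) (i!*mCi≤m^i m i) ⟩
    suc m * m ^ i               ≤⟨ *-monoʳ-≤ (suc m) (^-monoˡ-≤ i (n≤1+n m)) ⟩
    suc m ^ suc i               ∎
    where open ≤-Reasoning

  -- Each of the `i` factors of the falling factorial exceeds m - i. For `m` below `i` the truncated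
  -- subtraction makes the left side 0.
  [m∸i]^i≤i!*mCi : ∀ m i → (m ∸ i) ^ i ≤ i ! * (m C i)
  [m∸i]^i≤i!*mCi m       zero    = ≤-refl
  [m∸i]^i≤i!*mCi zero    (suc i) = z≤n
  [m∸i]^i≤i!*mCi (suc m) (suc i) = begin
    (m ∸ i) * (m ∸ i) ^ i       ≤⟨ *-mono-≤ (≤-trans (m∸n≤m m i) (n≤1+n m)) ([m∸i]^i≤i!*mCi m i) ⟩
    suc m * (i ! * (m C i))     ≡⟨ [i+1]!*[m+1]C[i+1]≡[m+1]*i!*mCi m i ⟨
    suc i ! * (suc m C suc i)   ∎
    where open ≤-Reasoning

  -- Counting sublists of a blown-up list.

  -- A weight `F` in place of a predicate lets one pair of bounds serve twice: an indicator gives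
  -- the occurrences of a pattern, `const 1` gives the number of all subsets.
  ∑sublists : ℕ → List A → (List A → ℕ) → ℕ
  ∑sublists zero    xs       F = F []
  ∑sublists (suc j) []       F = 0
  ∑sublists (suc j) (x ∷ xs) F = ∑sublists j xs (F ∘ (x ∷_)) + ∑sublists (suc j) xs F

  -- The k-multisets of entries of xs, each listed in the order of xs and weighted
  -- by the multinomial coefficient k! / ∏ mᵢ! of its multiplicities mᵢ.
  ∑multisets : ℕ → List A → (List A → ℕ) → ℕ
  ∑multisets zero    xs       F = F []
  ∑multisets (suc k) []       F = 0
  ∑multisets (suc k) (x ∷ xs) F =
    Σ≤ (suc k) (λ i → (suc k C i) * ∑multisets (suc k ∸ i) xs (F ∘ (replicate i x ++_)))

  blowUp : ℕ → List A → List A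
  blowUp m []       = []
  blowUp m (x ∷ xs) = replicate m x ++ blowUp m xs

  -- A sublist takes some number `i` of the `m` equal copies, in `m C i` ways that `F` cannot tell
  -- apart. The induction on `m` is Pascal's rule.
  ∑sublists-replicate : ∀ m (x : A) j ys F →
    ∑sublists j (replicate m x ++ ys) F ≡
    Σ≤ j (λ i → (m C i) * ∑sublists (j ∸ i) ys (F ∘ (replicate i x ++_)))
  ∑sublists-replicate m       x zero    ys F = sym (*-identityˡ _)
  ∑sublists-replicate zero    x (suc j) ys F = sym (begin
    1 * ∑sublists (suc j) ys F + Σ≤ j (λ _ → 0)  ≡⟨ cong₂ _+_ (*-identityˡ _) (Σ≤-zero j) ⟩
    ∑sublists (suc j) ys F + 0                   ≡⟨ +-identityʳ _ ⟩
    ∑sublists (suc j) ys F                       ∎)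
    where open ≡-Reasoning
  ∑sublists-replicate (suc m) x (suc j) ys F = begin
    ∑sublists j (replicate m x ++ ys) (F ∘ (x ∷_)) + ∑sublists (suc j) (replicate m x ++ ys) F
      ≡⟨ cong₂ _+_ (∑sublists-replicate m x j ys (F ∘ (x ∷_))) (∑sublists-replicate m x (suc j) ys F) ⟩
    Σ≤ j (λ i → (m C i) * G i) + (1 * ∑sublists (suc j) ys F + Σ≤ j (λ i → (m C suc i) * G i))
      ≡⟨ solve 3 (λ a b c → a :+ (b :+ c) := b :+ (a :+ c)) refl
           (Σ≤ j (λ i → (m C i) * G i)) (1 * ∑sublists (suc j) ys F) (Σ≤ j (λ i → (m C suc i) * G i)) ⟩
    1 * ∑sublists (suc j) ys F + (Σ≤ j (λ i → (m C i) * G i) + Σ≤ j (λ i → (m C suc i) * G i))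
      ≡⟨ cong (_+_ (1 * ∑sublists (suc j) ys F)) (Σ≤-+ j _ _) ⟨
    1 * ∑sublists (suc j) ys F + Σ≤ j (λ i → (m C i) * G i + (m C suc i) * G i)
      ≡⟨ cong (_+_ (1 * ∑sublists (suc j) ys F)) (Σ≤-cong j λ i _ →
           trans (sym (*-distribʳ-+ (G i) (m C i) (m C suc i)))
                 (cong (_* G i) (nCk+nC[k+1]≡[n+1]C[k+1] m i))) ⟩
    1 * ∑sublists (suc j) ys F + Σ≤ j (λ i → (suc m C suc i) * G i) ∎
    where
    open ≡-Reasoning
    open +-*-Solver
    G : ℕ → ℕ
    G i = ∑sublists (j ∸ i) ys (F ∘ (x ∷_) ∘ (replicate i x ++_))

  private
    -- Writing `j !` as a binomial coefficient times `i !` and `(j ∸ i) !` gives each factorial a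
    -- partner: `i !` completes `m C i` to a falling factorial, and `(j ∸ i) !` meets the sum
    -- bounded by induction. `factor-^` splits the power in the same shape, so the two sides compare
    -- factor by factor.
    factor-! : ∀ {j i} c s → i ≤ j → j ! * (c * s) ≡ (j C i) * ((i ! * c) * ((j ∸ i) ! * s))
    factor-! {j} {i} c s i≤j = begin
      j ! * (c * s)
        ≡⟨ cong (λ k → k ! * (c * s)) (m+[n∸m]≡n i≤j) ⟨
      (i + (j ∸ i)) ! * (c * s)
        ≡⟨ cong (_* (c * s)) ([i+k]Ci*i!*k!≡[i+k]! i (j ∸ i)) ⟨
      ((i + (j ∸ i)) C i) * (i ! * (j ∸ i) !) * (c * s)
        ≡⟨ cong (λ k → (k C i) * (i ! * (j ∸ i) !) * (c * s)) (m+[n∸m]≡n i≤j) ⟩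
      (j C i) * (i ! * (j ∸ i) !) * (c * s)
        ≡⟨ solve 5 (λ b p q c s → b :* (p :* q) :* (c :* s) := b :* ((p :* c) :* (q :* s))) refl
             (j C i) (i !) ((j ∸ i) !) c s ⟩
      (j C i) * ((i ! * c) * ((j ∸ i) ! * s)) ∎
      where
      open ≡-Reasoning
      open +-*-Solver

    factor-^ : ∀ {j i} t b w → i ≤ j → t ^ j * (b * w) ≡ b * (t ^ i * (t ^ (j ∸ i) * w))
    factor-^ {j} {i} t b w i≤j = begin
      t ^ j * (b * w)
        ≡⟨ cong (λ k → t ^ k * (b * w)) (m+[n∸m]≡n i≤j) ⟨
      t ^ (i + (j ∸ i)) * (b * w)
        ≡⟨ cong (_* (b * w)) (^-distribˡ-+-* t i (j ∸ i)) ⟩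
      t ^ i * t ^ (j ∸ i) * (b * w)
        ≡⟨ solve 4 (λ p q b w → p :* q :* (b :* w) := b :* (p :* (q :* w))) refl
             (t ^ i) (t ^ (j ∸ i)) b w ⟩
      b * (t ^ i * (t ^ (j ∸ i) * w)) ∎
      where
      open ≡-Reasoning
      open +-*-Solver

  ∑sublists-blowUp-upper : ∀ m j (xs : List A) F →
    j ! * ∑sublists j (blowUp m xs) F ≤ m ^ j * ∑multisets j xs F
  ∑sublists-blowUp-upper m zero      xs       F = ≤-refl
  ∑sublists-blowUp-upper m (suc j)   []       F = ≤-trans (≤-reflexive (*-zeroʳ (suc j !))) z≤n
  ∑sublists-blowUp-upper m j@(suc _) (x ∷ xs) F = begin
    j ! * ∑sublists j (replicate m x ++ blowUp m xs) F
      ≡⟨ cong (j ! *_) (∑sublists-replicate m x j (blowUp m xs) F) ⟩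
    j ! * Σ≤ j (λ i → (m C i) * s i)
      ≡⟨ *-distribˡ-Σ≤ (j !) j (λ i → (m C i) * s i) ⟩
    Σ≤ j (λ i → j ! * ((m C i) * s i))
      ≤⟨ Σ≤-mono j (λ i i≤j → begin
           j ! * ((m C i) * s i)                           ≡⟨ factor-! (m C i) (s i) i≤j ⟩
           (j C i) * ((i ! * (m C i)) * ((j ∸ i) ! * s i)) ≤⟨ *-monoʳ-≤ (j C i) (*-mono-≤ (i!*mCi≤m^i m i)
                                                                (∑sublists-blowUp-upper m (j ∸ i) xs _)) ⟩
           (j C i) * (m ^ i * (m ^ (j ∸ i) * w i))         ≡⟨ factor-^ m (j C i) (w i) i≤j ⟨
           m ^ j * ((j C i) * w i)                         ∎) ⟩
    Σ≤ j (λ i → m ^ j * ((j C i) * w i))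
      ≡⟨ *-distribˡ-Σ≤ (m ^ j) j (λ i → (j C i) * w i) ⟨
    m ^ j * Σ≤ j (λ i → (j C i) * w i) ∎
    where
    open ≤-Reasoning
    s w : ℕ → ℕ
    s i = ∑sublists (j ∸ i) (blowUp m xs) (F ∘ (replicate i x ++_))
    w i = ∑multisets (j ∸ i) xs (F ∘ (replicate i x ++_))

  -- The deficit `d` is separate from `j` so that the base `m ∸ d` stays fixed while the recursion
  -- passes from `j` to `j ∸ i`. In the application `d` and `j` are both `k`.
  ∑sublists-blowUp-lower : ∀ m d j (xs : List A) F → j ≤ d →
    (m ∸ d) ^ j * ∑multisets j xs F ≤ j ! * ∑sublists j (blowUp m xs) F
  ∑sublists-blowUp-lower m d zero      xs       F j≤d = ≤-refl
  ∑sublists-blowUp-lower m d (suc j)   []       F j≤d = ≤-trans (≤-reflexive (*-zeroʳ ((m ∸ d) ^ suc j))) z≤n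
  ∑sublists-blowUp-lower m d j@(suc _) (x ∷ xs) F j≤d = begin
    (m ∸ d) ^ j * Σ≤ j (λ i → (j C i) * w i)
      ≡⟨ *-distribˡ-Σ≤ ((m ∸ d) ^ j) j (λ i → (j C i) * w i) ⟩
    Σ≤ j (λ i → (m ∸ d) ^ j * ((j C i) * w i))
      ≤⟨ Σ≤-mono j (λ i i≤j → begin
           (m ∸ d) ^ j * ((j C i) * w i)                       ≡⟨ factor-^ (m ∸ d) (j C i) (w i) i≤j ⟩
           (j C i) * ((m ∸ d) ^ i * ((m ∸ d) ^ (j ∸ i) * w i)) ≤⟨ *-monoʳ-≤ (j C i) (*-mono-≤
                                                                    (lower i (≤-trans i≤j j≤d))
                                                                    (∑sublists-blowUp-lower m d (j ∸ i) xs _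
                                                                      (≤-trans (m∸n≤m j i) j≤d))) ⟩
           (j C i) * ((i ! * (m C i)) * ((j ∸ i) ! * s i))     ≡⟨ factor-! (m C i) (s i) i≤j ⟨
           j ! * ((m C i) * s i)                               ∎) ⟩
    Σ≤ j (λ i → j ! * ((m C i) * s i))
      ≡⟨ *-distribˡ-Σ≤ (j !) j (λ i → (m C i) * s i) ⟨
    j ! * Σ≤ j (λ i → (m C i) * s i)
      ≡⟨ cong (j ! *_) (∑sublists-replicate m x j (blowUp m xs) F) ⟨
    j ! * ∑sublists j (replicate m x ++ blowUp m xs) F ∎
    where
    open ≤-Reasoning
    s w : ℕ → ℕ
    s i = ∑sublists (j ∸ i) (blowUp m xs) (F ∘ (replicate i x ++_))
    w i = ∑multisets (j ∸ i) xs (F ∘ (replicate i x ++_))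
    lower : ∀ i → i ≤ d → (m ∸ d) ^ i ≤ i ! * (m C i)
    lower i i≤d = ≤-trans (^-monoˡ-≤ i (∸-monoʳ-≤ m i≤d)) ([m∸i]^i≤i!*mCi m i)

  -- Subsets of positions as sublists.

  Increasing : Vec (Fin n) k → Set
  Increasing v = ∀ p q → p Fin.< q → lookup v p Fin.< lookup v q

  indicator : Bool → ℕ
  indicator b = if b then 1 else 0

  length-filter : (p : A → Bool) (xs : List A) →
    length (filter (λ x → p x ≟ᵇ true) xs) ≡ sum (List.map (indicator ∘ p) xs)
  length-filter p []       = refl
  length-filter p (x ∷ xs) with p x
  ... | true  = cong suc (length-filter p xs)
  ... | false = length-filter p xs

  length≡sum : (xs : List A) → length xs ≡ sum (List.map (const 1) xs)
  length≡sum []       = refl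
  length≡sum (x ∷ xs) = cong suc (length≡sum xs)

  increasing-map-suc : (v : Vec (Fin n) k) → Increasing v → Increasing (Vec.map suc v)
  increasing-map-suc v v↑ p q p<q
    rewrite Vec.lookup-map p Fin.suc v | Vec.lookup-map q Fin.suc v = s≤s (v↑ p q p<q)

  increasing-zero∷ : (v : Vec (Fin n) k) → Increasing v → Increasing (zero ∷ Vec.map suc v)
  increasing-zero∷ v v↑ zero    (suc q) _ rewrite Vec.lookup-map q Fin.suc v = z<s
  increasing-zero∷ v v↑ (suc p) (suc q) p<q = increasing-map-suc v v↑ p q (s<s⁻¹ p<q)

  -- Agreement of `G` and `F` is asked on increasing vectors only, the sole ones that `subsets`
  -- lists: the blocks of two positions determine the order of their values only if it is known
  -- which position comes first.
  sum-subsets : ∀ n k (key : Fin n → A) (G : Vec (Fin n) k → ℕ) (F : List A → ℕ) →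
    (∀ v → Increasing v → G v ≡ F (toList (Vec.map key v))) →
    sum (List.map G (subsets n k)) ≡ ∑sublists k (tabulate key) F
  sum-subsets n       zero    key G F G≡F = trans (+-identityʳ _) (G≡F [] λ ())
  sum-subsets zero    (suc k) key G F G≡F = refl
  sum-subsets (suc n) (suc k) key G F G≡F = begin
    sum (List.map G (List.map with-zero (subsets n k) ++ List.map (Vec.map suc) (subsets n (suc k))))
      ≡⟨ cong sum (List.map-++ G (List.map with-zero (subsets n k)) _) ⟩
    sum (List.map G (List.map with-zero (subsets n k)) ++ List.map G (List.map (Vec.map suc) (subsets n (suc k))))
      ≡⟨ sum-++ (List.map G (List.map with-zero (subsets n k))) _ ⟩
    sum (List.map G (List.map with-zero (subsets n k))) + sum (List.map G (List.map (Vec.map suc) (subsets n (suc k))))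
      ≡⟨ cong₂ (λ xs ys → sum xs + sum ys) (List.map-∘ (subsets n k)) (List.map-∘ (subsets n (suc k))) ⟨
    sum (List.map (G ∘ with-zero) (subsets n k)) + sum (List.map (G ∘ Vec.map suc) (subsets n (suc k)))
      ≡⟨ cong₂ _+_
           (sum-subsets n k (key ∘ suc) _ (F ∘ (key zero ∷_)) λ v v↑ →
             trans (G≡F (with-zero v) (increasing-zero∷ v v↑))
                   (cong (F ∘ (key zero ∷_) ∘ toList) (sym (Vec.map-∘ key suc v))))
           (sum-subsets n (suc k) (key ∘ suc) _ F λ v v↑ →
             trans (G≡F (Vec.map suc v) (increasing-map-suc v v↑))
                   (cong (F ∘ toList) (sym (Vec.map-∘ key suc v)))) ⟩
    ∑sublists (suc k) (tabulate key) F ∎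
    where
    open ≡-Reasoning
    with-zero : Vec (Fin n) k → Vec (Fin (suc n)) (suc k)
    with-zero v = zero ∷ Vec.map suc v

  tabulate-↑ : ∀ m n (f : Fin (m + n) → A) →
    tabulate f ≡ tabulate (λ i → f (i ↑ˡ n)) ++ tabulate (λ i → f (m ↑ʳ i))
  tabulate-↑ zero    n f = refl
  tabulate-↑ (suc m) n f = cong (f zero ∷_) (tabulate-↑ m n (f ∘ suc))

  tabulate-const : ∀ m (x : A) → tabulate {n = m} (λ _ → x) ≡ replicate m x
  tabulate-const zero    x = refl
  tabulate-const (suc m) x = cong (x ∷_) (tabulate-const m x)

  tabulate-combine : ∀ n m (f : Fin (n * m) → A) (g : Fin n → A) →
    (∀ i x → f (combine i x) ≡ g i) → tabulate f ≡ blowUp m (tabulate g)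
  tabulate-combine zero    m f g f≡g = refl
  tabulate-combine (suc n) m f g f≡g = begin
    tabulate f
      ≡⟨ tabulate-↑ m (n * m) f ⟩
    tabulate (λ x → f (x ↑ˡ (n * m))) ++ tabulate (λ i → f (m ↑ʳ i))
      ≡⟨ cong₂ _++_ (trans (List.tabulate-cong (f≡g zero)) (tabulate-const m (g zero)))
                    (tabulate-combine n m (λ i → f (m ↑ʳ i)) (g ∘ suc) (λ i → f≡g (suc i))) ⟩
    blowUp m (tabulate g) ∎
    where open ≡-Reasoning

  -- Inflations, and reading patterns from their blocks.

  -- A monotone run, given by its rank among the runs and by whether it is increasing.
  Block : Set
  Block = ℕ × Bool

  -- Whether a point of the first run lies below a later point of the second.
  below : Block → Block → Bool
  below (a , ↗) (b , _) = if a ≡ᵇ b then ↗ else a <ᵇ b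

  -- Only pairs in left-to-right order are tested; `induces` tests all ordered pairs. The default
  -- `true` ends the recursion when the lists, of equal length in every application, run out
  -- together.
  matchesRow : ℕ → Block → List ℕ → List Block → Bool
  matchesRow s x (t ∷ ts) (y ∷ ys) = boolEq (below x y) (s <ᵇ t) ∧ matchesRow s x ts ys
  matchesRow s x _        _        = true

  matches : List ℕ → List Block → Bool
  matches (s ∷ ss) (x ∷ xs) = matchesRow s x ss xs ∧ matches ss xs
  matches _        _        = true

  word : Perm k → List ℕ
  word σ = toList (Vec.tabulate (λ i → suc (toℕ (σ ⟨$⟩ʳ i))))

  orient : Bool → Fin m → Fin m
  orient ↗ x = if ↗ then x else opposite x

  orient-involutive : ∀ ↗ (x : Fin m) → orient ↗ (orient ↗ x) ≡ x
  orient-involutive true  x = refl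
  orient-involutive false x = Fin.opposite-involutive x

  module _ (τ : Perm n) (↗ : Fin n → Bool) where

    block : Fin n → Block
    block i = suc (toℕ (τ ⟨$⟩ʳ i)) , ↗ i

    blocks : List Block
    blocks = tabulate block

    private
      to from : ∀ m → Fin n × Fin m → Fin (n * m)
      to   m (i , x) = combine (τ ⟨$⟩ʳ i) (orient (↗ i) x)
      from m (i , x) = combine (τ ⟨$⟩ˡ i) (orient (↗ (τ ⟨$⟩ˡ i)) x)

      to-from : ∀ m i x → to m (remQuot m (from m (i , x))) ≡ combine i x
      to-from m i x = begin
        to m (remQuot m (from m (i , x)))
          ≡⟨ cong (to m) (Fin.remQuot-combine (τ ⟨$⟩ˡ i) (orient (↗ (τ ⟨$⟩ˡ i)) x)) ⟩
        combine (τ ⟨$⟩ʳ (τ ⟨$⟩ˡ i)) (orient (↗ (τ ⟨$⟩ˡ i)) (orient (↗ (τ ⟨$⟩ˡ i)) x))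
          ≡⟨ cong₂ combine (inverseʳ τ) (orient-involutive (↗ (τ ⟨$⟩ˡ i)) x) ⟩
        combine i x ∎
        where open ≡-Reasoning

      from-to : ∀ m i x → from m (remQuot m (to m (i , x))) ≡ combine i x
      from-to m i x = begin
        from m (remQuot m (to m (i , x)))
          ≡⟨ cong (from m) (Fin.remQuot-combine (τ ⟨$⟩ʳ i) (orient (↗ i) x)) ⟩
        combine (τ ⟨$⟩ˡ (τ ⟨$⟩ʳ i)) (orient (↗ (τ ⟨$⟩ˡ (τ ⟨$⟩ʳ i))) (orient (↗ i) x))
          ≡⟨ cong (λ j → combine j (orient (↗ j) (orient (↗ i) x))) (inverseˡ τ) ⟩
        combine i (orient (↗ i) (orient (↗ i) x))
          ≡⟨ cong (combine i) (orient-involutive (↗ i) x) ⟩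
        combine i x ∎
        where open ≡-Reasoning

    -- Position m·i + x receives the value m·τ(i) + x in an increasing run and m·τ(i) + (m-1-x) in a
    -- decreasing one. Since `orient` is an involution, the inverse applies it again, with the
    -- orientation of the run τ⁻¹(i) that the value came from.
    inflation : ∀ m → Perm (n * m)
    inflation m = permutation (to m ∘ remQuot m) (from m ∘ remQuot m)
      (λ i → trans (uncurry (to-from m) (remQuot m i)) (Fin.combine-remQuot {n} m i))
      (λ i → trans (uncurry (from-to m) (remQuot m i)) (Fin.combine-remQuot {n} m i))

    blockAt : ∀ m → Fin (n * m) → Block
    blockAt m = block ∘ quotient m

    tabulate-blockAt : ∀ m → tabulate (blockAt m) ≡ blowUp m blocks
    tabulate-blockAt m = tabulate-combine n m (blockAt m) block
      (λ i x → cong (block ∘ proj₁) (Fin.remQuot-combine i x))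

  <⇒<ᵇ≡true : ∀ {a b} → a < b → (a <ᵇ b) ≡ true
  <⇒<ᵇ≡true {a} {b} a<b with a <ᵇ b | <⇒<ᵇ a<b
  ... | true | _ = refl

  ≮⇒<ᵇ≡false : ∀ {a b} → b ≤ a → (a <ᵇ b) ≡ false
  ≮⇒<ᵇ≡false {a} {b} b≤a with a <ᵇ b in eq
  ... | false = refl
  ... | true  = contradiction (<ᵇ⇒< a b (subst T (sym eq) _)) (≤⇒≯ b≤a)

  <ᵇ-irrefl : ∀ a → (a <ᵇ a) ≡ false
  <ᵇ-irrefl a = ≮⇒<ᵇ≡false {a} ≤-refl

  ≡ᵇ-refl : ∀ a → (a ≡ᵇ a) ≡ true
  ≡ᵇ-refl zero    = refl
  ≡ᵇ-refl (suc a) = ≡ᵇ-refl a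

  ≢⇒≡ᵇ≡false : ∀ {a b} → a ≢ b → (a ≡ᵇ b) ≡ false
  ≢⇒≡ᵇ≡false {a} {b} a≢b with a ≡ᵇ b in eq
  ... | false = refl
  ... | true  = contradiction (≡ᵇ⇒≡ a b (subst T (sym eq) _)) a≢b

  combine-cancelʳ-< : ∀ (i : Fin n) {x y : Fin m} → combine i x Fin.< combine i y → x Fin.< y
  combine-cancelʳ-< {m = m} i {x} {y} lt =
    +-cancelˡ-< (m * toℕ i) (toℕ x) (toℕ y) (subst₂ _<_ (Fin.toℕ-combine i x) (Fin.toℕ-combine i y) lt)

  combine-monoʳ-< : ∀ (i : Fin n) {x y : Fin m} → x Fin.< y → combine i x Fin.< combine i y
  combine-monoʳ-< {m = m} i {x} {y} lt =
    subst₂ _<_ (sym (Fin.toℕ-combine i x)) (sym (Fin.toℕ-combine i y)) (+-monoʳ-< (m * toℕ i) lt)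

  opposite-anti-< : ∀ {x y : Fin m} → x Fin.< y → opposite y Fin.< opposite x
  opposite-anti-< {x = x} {y} x<y =
    subst₂ _<_ (sym (Fin.opposite-prop y)) (sym (Fin.opposite-prop x)) (∸-monoʳ-< (s<s x<y) (Fin.toℕ<n y))

  module _ (τ : Perm n) (↗ : Fin n → Bool) (m : ℕ) where

    private
      π = inflation τ ↗ m

      -- Points of distinct runs compare as their runs do, whatever the offsets. Within one run the
      -- common index cancels, and the orientation decides whether the order of the offsets is kept
      -- or reversed.
      below-combine : ∀ i (x : Fin m) j (y : Fin m) → combine i x Fin.< combine j y →
        (toℕ (combine (τ ⟨$⟩ʳ i) (orient (↗ i) x)) <ᵇ toℕ (combine (τ ⟨$⟩ʳ j) (orient (↗ j) y)))
          ≡ below (block τ ↗ i) (block τ ↗ j)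
      below-combine i x j y lt with i Fin.≟ j
      ... | yes refl rewrite ≡ᵇ-refl (toℕ (τ ⟨$⟩ʳ i)) = same-block (↗ i)
        where
        x<y = combine-cancelʳ-< i lt
        same-block : ∀ b → (toℕ (combine (τ ⟨$⟩ʳ i) (orient b x)) <ᵇ toℕ (combine (τ ⟨$⟩ʳ i) (orient b y))) ≡ b
        same-block true  = <⇒<ᵇ≡true (combine-monoʳ-< (τ ⟨$⟩ʳ i) x<y)
        same-block false = ≮⇒<ᵇ≡false (<⇒≤ (combine-monoʳ-< (τ ⟨$⟩ʳ i) (opposite-anti-< x<y)))
      ... | no i≢j with Fin.<-cmp (τ ⟨$⟩ʳ i) (τ ⟨$⟩ʳ j)
      ...   | tri< τi<τj τi≢τj _
        rewrite ≢⇒≡ᵇ≡false (τi≢τj ∘ Fin.toℕ-injective) | <⇒<ᵇ≡true τi<τj =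
          <⇒<ᵇ≡true (Fin.combine-monoˡ-< (orient (↗ i) x) (orient (↗ j) y) τi<τj)
      ...   | tri≈ _ τi≡τj _ = contradiction
          (trans (sym (inverseˡ τ)) (trans (cong (τ ⟨$⟩ˡ_) τi≡τj) (inverseˡ τ))) i≢j
      ...   | tri> _ τi≢τj τj<τi
        rewrite ≢⇒≡ᵇ≡false (τi≢τj ∘ Fin.toℕ-injective) | ≮⇒<ᵇ≡false (<⇒≤ τj<τi) =
          ≮⇒<ᵇ≡false (<⇒≤ (Fin.combine-monoˡ-< (orient (↗ j) y) (orient (↗ i) x) τj<τi))

    inflation-below : ∀ {a b} → a Fin.< b →
      (toℕ (π ⟨$⟩ʳ a) <ᵇ toℕ (π ⟨$⟩ʳ b)) ≡ below (blockAt τ ↗ m a) (blockAt τ ↗ m b)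
    inflation-below {a} {b} a<b = below-combine _ _ _ _
      (subst₂ Fin._<_ (sym (Fin.combine-remQuot {n} m a)) (sym (Fin.combine-remQuot {n} m b)) a<b)

  -- Equivalence of the two pattern tests.

  ∧-true⁻ : ∀ {a b} → a ∧ b ≡ true → a ≡ true × b ≡ true
  ∧-true⁻ {true} eq = refl , eq

  ∧-true⁺ : ∀ {a b} → a ≡ true → b ≡ true → a ∧ b ≡ true
  ∧-true⁺ refl eq = eq

  bool-ext : ∀ {a b} → (a ≡ true → b ≡ true) → (b ≡ true → a ≡ true) → a ≡ b
  bool-ext {true}          f g = sym (f refl)
  bool-ext {false} {true}  f g = g refl
  bool-ext {false} {false} f g = refl

  boolEq-sound : ∀ a {b} → boolEq a b ≡ true → a ≡ b
  boolEq-sound true          eq = sym eq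
  boolEq-sound false {false} eq = refl

  boolEq-refl : ∀ a → boolEq a a ≡ true
  boolEq-refl true  = refl
  boolEq-refl false = refl

  and-tabulate⁻ : ∀ {k} (f : Fin k → Bool) → and (tabulate f) ≡ true → ∀ i → f i ≡ true
  and-tabulate⁻ f eq zero    = proj₁ (∧-true⁻ eq)
  and-tabulate⁻ f eq (suc i) = and-tabulate⁻ (f ∘ suc) (proj₂ (∧-true⁻ {f zero} eq)) i

  and-tabulate⁺ : ∀ {k} (f : Fin k → Bool) → (∀ i → f i ≡ true) → and (tabulate f) ≡ true
  and-tabulate⁺ {zero}  f eq = refl
  and-tabulate⁺ {suc k} f eq = ∧-true⁺ (eq zero) (and-tabulate⁺ (f ∘ suc) (eq ∘ suc))

  and-allFin⁻ : ∀ {k} (f : Fin k → Bool) → and (List.map f (allFin k)) ≡ true → ∀ i → f i ≡ true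
  and-allFin⁻ f eq = and-tabulate⁻ f (subst (λ xs → and xs ≡ true) (List.map-tabulate (λ i → i) f) eq)

  and-allFin⁺ : ∀ {k} (f : Fin k → Bool) → (∀ i → f i ≡ true) → and (List.map f (allFin k)) ≡ true
  and-allFin⁺ f eq = subst (λ xs → and xs ≡ true) (sym (List.map-tabulate (λ i → i) f)) (and-tabulate⁺ f eq)

  matchesRow⁻ : ∀ s x (ts : Vec ℕ k) ys → matchesRow s x (toList ts) (toList ys) ≡ true →
    ∀ q → below x (lookup ys q) ≡ (s <ᵇ lookup ts q)
  matchesRow⁻ s x (t ∷ ts) (y ∷ ys) eq zero    = boolEq-sound (below x y) (proj₁ (∧-true⁻ eq))
  matchesRow⁻ s x (t ∷ ts) (y ∷ ys) eq (suc q) =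
    matchesRow⁻ s x ts ys (proj₂ (∧-true⁻ {boolEq (below x y) (s <ᵇ t)} eq)) q

  matchesRow⁺ : ∀ s x (ts : Vec ℕ k) ys → (∀ q → below x (lookup ys q) ≡ (s <ᵇ lookup ts q)) →
    matchesRow s x (toList ts) (toList ys) ≡ true
  matchesRow⁺ s x []       []       eq = refl
  matchesRow⁺ s x (t ∷ ts) (y ∷ ys) eq = ∧-true⁺
    (trans (cong (λ b → boolEq b (s <ᵇ t)) (eq zero)) (boolEq-refl (s <ᵇ t)))
    (matchesRow⁺ s x ts ys (eq ∘ suc))

  matches⁻ : ∀ (ss : Vec ℕ k) xs → matches (toList ss) (toList xs) ≡ true →
    ∀ p q → p Fin.< q → below (lookup xs p) (lookup xs q) ≡ (lookup ss p <ᵇ lookup ss q)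
  matches⁻ (s ∷ ss) (x ∷ xs) eq zero    (suc q) _   = matchesRow⁻ s x ss xs (proj₁ (∧-true⁻ eq)) q
  matches⁻ (s ∷ ss) (x ∷ xs) eq (suc p) (suc q) p<q =
    matches⁻ ss xs (proj₂ (∧-true⁻ {matchesRow s x (toList ss) (toList xs)} eq)) p q (s<s⁻¹ p<q)

  matches⁺ : ∀ (ss : Vec ℕ k) xs →
    (∀ p q → p Fin.< q → below (lookup xs p) (lookup xs q) ≡ (lookup ss p <ᵇ lookup ss q)) →
    matches (toList ss) (toList xs) ≡ true
  matches⁺ []       []       eq = refl
  matches⁺ (s ∷ ss) (x ∷ xs) eq = ∧-true⁺
    (matchesRow⁺ s x ss xs (λ q → eq zero (suc q) z<s))
    (matches⁺ ss xs (λ p q p<q → eq (suc p) (suc q) (s<s p<q)))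

  <ᵇ-flip : ∀ {a b} → a ≢ b → (b <ᵇ a) ≡ not (a <ᵇ b)
  <ᵇ-flip {a} {b} a≢b with <-cmp a b
  ... | tri< a<b _ _ rewrite <⇒<ᵇ≡true a<b | ≮⇒<ᵇ≡false (<⇒≤ a<b) = refl
  ... | tri≈ _ a≡b _ = contradiction a≡b a≢b
  ... | tri> _ _ b<a rewrite <⇒<ᵇ≡true b<a | ≮⇒<ᵇ≡false (<⇒≤ b<a) = refl

  perm-injective : (π : Perm n) → ∀ {i j} → toℕ (π ⟨$⟩ʳ i) ≡ toℕ (π ⟨$⟩ʳ j) → i ≡ j
  perm-injective π eq = trans (sym (inverseˡ π)) (trans (cong (π ⟨$⟩ˡ_) (Fin.toℕ-injective eq)) (inverseˡ π))

  -- The pairs p < q are what `matches` tests. On the diagonal both comparisons are false, and a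
  -- pair q < p is the negation of its reverse, because the values of a permutation at distinct
  -- points differ.
  induces≡matches : ∀ (σ : Perm k) (τ : Perm n) (↗ : Fin n → Bool) m (v : Vec (Fin (n * m)) k) →
    Increasing v →
    induces σ (inflation τ ↗ m) v ≡ matches (word σ) (toList (Vec.map (blockAt τ ↗ m) v))
  induces≡matches {k} σ τ ↗ m v v↑ = bool-ext forwards backwards
    where
    π = inflation τ ↗ m
    ss = Vec.tabulate (λ i → suc (toℕ (σ ⟨$⟩ʳ i)))
    xs = Vec.map (blockAt τ ↗ m) v
    σ< π< : Fin k → Fin k → Bool
    σ< p q = toℕ (σ ⟨$⟩ʳ p) <ᵇ toℕ (σ ⟨$⟩ʳ q)
    π< p q = toℕ (π ⟨$⟩ʳ lookup v p) <ᵇ toℕ (π ⟨$⟩ʳ lookup v q)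

    below≡π< : ∀ p q → p Fin.< q → below (lookup xs p) (lookup xs q) ≡ π< p q
    below≡π< p q p<q rewrite Vec.lookup-map p (blockAt τ ↗ m) v | Vec.lookup-map q (blockAt τ ↗ m) v =
      sym (inflation-below τ ↗ m (v↑ p q p<q))

    ss≡σ< : ∀ p q → (lookup ss p <ᵇ lookup ss q) ≡ σ< p q
    ss≡σ< p q = cong₂ _<ᵇ_ (Vec.lookup∘tabulate _ p) (Vec.lookup∘tabulate _ q)

    forwards : induces σ π v ≡ true → matches (toList ss) (toList xs) ≡ true
    forwards eq = matches⁺ ss xs λ p q p<q → trans (below≡π< p q p<q)
      (trans (boolEq-sound (π< p q) (and-allFin⁻ _ (and-allFin⁻ _ eq p) q)) (sym (ss≡σ< p q)))

    backwards : matches (toList ss) (toList xs) ≡ true → induces σ π v ≡ true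
    backwards eq = and-allFin⁺ _ λ p → and-allFin⁺ _ λ q →
      trans (cong (λ b → boolEq b (σ< p q)) (agree p q)) (boolEq-refl (σ< p q))
      where
      agree< : ∀ p q → p Fin.< q → π< p q ≡ σ< p q
      agree< p q p<q = trans (sym (below≡π< p q p<q)) (trans (matches⁻ ss xs eq p q p<q) (ss≡σ< p q))
      agree : ∀ p q → π< p q ≡ σ< p q
      agree p q with Fin.<-cmp p q
      ... | tri< p<q _ _  = agree< p q p<q
      ... | tri≈ _ refl _ = trans (<ᵇ-irrefl (toℕ (π ⟨$⟩ʳ lookup v p))) (sym (<ᵇ-irrefl (toℕ (σ ⟨$⟩ʳ p))))
      ... | tri> _ p≢q q<p = begin
        π< p q        ≡⟨ <ᵇ-flip (λ e → <⇒≢ (v↑ q p q<p) (cong toℕ (perm-injective π e))) ⟩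
        not (π< q p)  ≡⟨ cong not (agree< q p q<p) ⟩
        not (σ< q p)  ≡⟨ <ᵇ-flip (λ e → p≢q (sym (perm-injective σ e))) ⟨
        σ< p q        ∎
        where open ≡-Reasoning


  occurrences-inflation : ∀ (σ : Perm k) (τ : Perm n) (↗ : Fin n → Bool) m →
    occurrences σ (inflation τ ↗ m) ≡
    ∑sublists k (blowUp m (blocks τ ↗)) (indicator ∘ matches (word σ))
  occurrences-inflation {k} {n} σ τ ↗ m = begin
    occurrences σ (inflation τ ↗ m)
      ≡⟨ length-filter (induces σ (inflation τ ↗ m)) (subsets (n * m) k) ⟩
    sum (List.map (indicator ∘ induces σ (inflation τ ↗ m)) (subsets (n * m) k))
      ≡⟨ sum-subsets (n * m) k (blockAt τ ↗ m) _ (indicator ∘ matches (word σ))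
           (λ v v↑ → cong indicator (induces≡matches σ τ ↗ m v v↑)) ⟩
    ∑sublists k (tabulate (blockAt τ ↗ m)) (indicator ∘ matches (word σ))
      ≡⟨ cong (λ xs → ∑sublists k xs (indicator ∘ matches (word σ))) (tabulate-blockAt τ ↗ m) ⟩
    ∑sublists k (blowUp m (blocks τ ↗)) (indicator ∘ matches (word σ)) ∎
    where open ≡-Reasoning

  length-subsets-inflation : ∀ k (τ : Perm n) (↗ : Fin n → Bool) m →
    length (subsets (n * m) k) ≡ ∑sublists k (blowUp m (blocks τ ↗)) (const 1)
  length-subsets-inflation {n} k τ ↗ m = begin
    length (subsets (n * m) k)
      ≡⟨ length≡sum (subsets (n * m) k) ⟩
    sum (List.map (const 1) (subsets (n * m) k))
      ≡⟨ sum-subsets (n * m) k (blockAt τ ↗ m) _ (const 1) (λ _ _ → refl) ⟩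
    ∑sublists k (tabulate (blockAt τ ↗ m)) (const 1)
      ≡⟨ cong (λ xs → ∑sublists k xs (const 1)) (tabulate-blockAt τ ↗ m) ⟩
    ∑sublists k (blowUp m (blocks τ ↗)) (const 1) ∎
    where open ≡-Reasoning

  -- From counting bounds to convergence of densities.

  -- This is (1+c)ᵏ - 1, since (1+c)(1+s) - 1 = c + s + cs.
  shiftConst : ℕ → ℕ → ℕ
  shiftConst c zero    = 0
  shiftConst c (suc k) = c + shiftConst c k + c * shiftConst c k

  -- Division-free form of (1 + c/n)ᵏ ≤ 1 + ((1+c)ᵏ - 1)/n: for n ≥ 1 every term of the expansion
  -- beyond the first carries at least one factor 1/n.
  n*[n+c]^k≤n^k*[n+shiftConst] : ∀ n .{{_ : NonZero n}} c k → n * (n + c) ^ k ≤ n ^ k * (n + shiftConst c k)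
  n*[n+c]^k≤n^k*[n+shiftConst] n c zero    =
    ≤-reflexive (solve 1 (λ n → n :* con 1 := con 1 :* (n :+ con 0)) refl n)
    where open +-*-Solver
  n*[n+c]^k≤n^k*[n+shiftConst] n c (suc k) = begin
    n * ((n + c) * (n + c) ^ k)
      ≡⟨ solve 3 (λ n c p → n :* ((n :+ c) :* p) := (n :+ c) :* (n :* p)) refl n c ((n + c) ^ k) ⟩
    (n + c) * (n * (n + c) ^ k)
      ≤⟨ *-monoʳ-≤ (n + c) (n*[n+c]^k≤n^k*[n+shiftConst] n c k) ⟩
    (n + c) * (n ^ k * (n + s))
      ≡⟨ solve 4 (λ n c s p → (n :+ c) :* (p :* (n :+ s)) := p :* (n :* (n :+ c :+ s) :+ c :* s)) refl n c s (n ^ k) ⟩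
    n ^ k * (n * (n + c + s) + c * s)
      ≤⟨ *-monoʳ-≤ (n ^ k) (+-monoʳ-≤ (n * (n + c + s)) (m≤n*m (c * s) n)) ⟩
    n ^ k * (n * (n + c + s) + n * (c * s))
      ≡⟨ solve 4 (λ n c s p → p :* (n :* (n :+ c :+ s) :+ n :* (c :* s)) := n :* p :* (n :+ (c :+ s :+ c :* s)))
           refl n c s (n ^ k) ⟩
    n * n ^ k * (n + (c + s + c * s)) ∎
    where
    open ≤-Reasoning
    open +-*-Solver
    s = shiftConst c k

  -- To be read with n = m - k, a = nᵏ, b = mᵏ and E the denominator of ε. Up to the factor f = k!,
  -- the counts `o` and `T` lie between a and b times `N` and `D`; the two conclusions say |o/T -
  -- N/D| < 1/E, cleared of denominators.
  module _ {n a b c N D E : ℕ} .{{_ : NonZero n}} .{{_ : NonZero a}} .{{_ : NonZero D}}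
           (b/a : n * b ≤ a * (n + c)) (n-large : c * N * E < n) where

    private
      -- This is (b/a)·N < N + D/E. By `b/a` the excess is at most cN/n, which `n-large` makes
      -- smaller than 1/E, and D ≥ 1. Both conclusions rest on this one gap between the upper and
      -- the lower bound.
      b-close : b * (N * E) < a * (N * E) + a * D
      b-close = *-cancelˡ-< n _ _ (begin-strict
        n * (b * (N * E))
          ≡⟨ *-assoc n b (N * E) ⟨
        n * b * (N * E)
          ≤⟨ *-monoˡ-≤ (N * E) b/a ⟩
        a * (n + c) * (N * E)
          ≡⟨ solve 5 (λ a n c N E → a :* (n :+ c) :* (N :* E) := n :* (a :* (N :* E)) :+ a :* (c :* N :* E)) refl a n c N E ⟩
        n * (a * (N * E)) + a * (c * N * E)
          <⟨ +-monoʳ-< (n * (a * (N * E))) (*-monoʳ-< a n-large) ⟩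
        n * (a * (N * E)) + a * n
          ≤⟨ +-monoʳ-≤ (n * (a * (N * E))) (*-monoʳ-≤ a (m≤m*n n D)) ⟩
        n * (a * (N * E)) + a * (n * D)
          ≡⟨ solve 4 (λ n a y D → n :* (a :* y) :+ a :* (n :* D) := n :* (a :* y :+ a :* D)) refl n a (N * E) D ⟩
        n * (a * (N * E) + a * D) ∎)
        where
        open ≤-Reasoning
        open +-*-Solver

    module _ (f o T : ℕ) (aN≤fo : a * N ≤ f * o) (fo≤bN : f * o ≤ b * N)
             (aD≤fT : a * D ≤ f * T) (fT≤bD : f * T ≤ b * D) where

      o*D-close : o * D * E < N * T * E + T * D
      o*D-close = *-cancelˡ-< f _ _ (begin-strict
        f * (o * D * E)
          ≡⟨ solve 4 (λ f o D E → f :* (o :* D :* E) := f :* o :* (D :* E)) refl f o D E ⟩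
        f * o * (D * E)
          ≤⟨ *-monoˡ-≤ (D * E) fo≤bN ⟩
        b * N * (D * E)
          ≡⟨ solve 4 (λ b N D E → b :* N :* (D :* E) := b :* (N :* E) :* D) refl b N D E ⟩
        b * (N * E) * D
          <⟨ *-monoˡ-< D b-close ⟩
        (a * (N * E) + a * D) * D
          ≡⟨ solve 4 (λ a N D E → (a :* (N :* E) :+ a :* D) :* D := a :* D :* (N :* E :+ D)) refl a N D E ⟩
        a * D * (N * E + D)
          ≤⟨ *-monoˡ-≤ (N * E + D) aD≤fT ⟩
        f * T * (N * E + D)
          ≡⟨ solve 5 (λ f T N E D → f :* T :* (N :* E :+ D) := f :* (N :* T :* E :+ T :* D)) refl f T N E D ⟩
        f * (N * T * E + T * D) ∎)
        where
        open ≤-Reasoning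
        open +-*-Solver

      N*T-close : N * T * E < o * D * E + T * D
      N*T-close = *-cancelˡ-< f _ _ (begin-strict
        f * (N * T * E)
          ≡⟨ solve 4 (λ f N T E → f :* (N :* T :* E) := f :* T :* (N :* E)) refl f N T E ⟩
        f * T * (N * E)
          ≤⟨ *-monoˡ-≤ (N * E) fT≤bD ⟩
        b * D * (N * E)
          ≡⟨ solve 3 (λ b D y → b :* D :* y := b :* y :* D) refl b D (N * E) ⟩
        b * (N * E) * D
          <⟨ *-monoˡ-< D b-close ⟩
        (a * (N * E) + a * D) * D
          ≡⟨ solve 4 (λ a N D E → (a :* (N :* E) :+ a :* D) :* D := a :* N :* (E :* D) :+ a :* D :* D) refl a N D E ⟩
        a * N * (E * D) + a * D * D
          ≤⟨ +-mono-≤ (*-monoˡ-≤ (E * D) aN≤fo) (*-monoˡ-≤ D aD≤fT) ⟩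
        f * o * (E * D) + f * T * D
          ≡⟨ solve 5 (λ f o T E D → f :* o :* (E :* D) :+ f :* T :* D := f :* (o :* D :* E :+ T :* D)) refl f o T E D ⟩
        f * (o * D * E + T * D) ∎)
        where
        open ≤-Reasoning
        open +-*-Solver

  ∣⊖∣*-< : ∀ x y {e z} .{{_ : NonZero z}} → x * e < y * e + z → y * e < x * e + z → ℤ.∣ x ⊖ y ∣ * e < z
  ∣⊖∣*-< x y {e} {z} x<y+z y<x+z with ≤-total x y
  ... | inj₁ x≤y = begin-strict
    ℤ.∣ x ⊖ y ∣ * e  ≡⟨ cong (_* e) (ℤ.∣⊖∣-≤ x≤y) ⟩
    (y ∸ x) * e      ≡⟨ *-distribʳ-∸ e y x ⟩
    y * e ∸ x * e    <⟨ m<n+o⇒m∸n<o (y * e) (x * e) y<x+z ⟩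
    z                ∎
    where open ≤-Reasoning
  ... | inj₂ y≤x = begin-strict
    ℤ.∣ x ⊖ y ∣ * e  ≡⟨ cong (λ i → ℤ.∣ i ∣ * e) (ℤ.⊖-≥ y≤x) ⟩
    (x ∸ y) * e      ≡⟨ *-distribʳ-∸ e x y ⟩
    x * e ∸ y * e    <⟨ m<n+o⇒m∸n<o (x * e) (y * e) x<y+z ⟩
    z                ∎
    where open ≤-Reasoning

  -- A positive rational is at least the reciprocal of its denominator, so a distance below 1/`↧ₙ ε`
  -- is enough.
  fractions-close : ∀ o T N D ε → 0ℚ ℚ.< ε →
    o * suc D * ℚ.↧ₙ ε < N * suc T * ℚ.↧ₙ ε + suc T * suc D →
    N * suc T * ℚ.↧ₙ ε < o * suc D * ℚ.↧ₙ ε + suc T * suc D →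
    ℚ.∣ + o ℚ./ suc T ℚ.- + N ℚ./ suc D ∣ ℚ.< ε
  fractions-close o T N D (mkℚ (+ 0)      q _) (*<* (ℤ.+<+ ()))
  fractions-close o T N D (mkℚ ℤ.-[1+ _ ] q _) (*<* ())
  fractions-close o T N D (mkℚ +[1+ p ]   q _) 0<ε o<N N<o = ℚ.toℚᵘ-cancel-< (begin-strict
    toℚᵘ ℚ.∣ x ℚ.- y ∣
      ≃⟨ ℚ.toℚᵘ-homo-∣-∣ (x ℚ.- y) ⟩
    ℚᵘ.∣ toℚᵘ (x ℚ.- y) ∣
      ≃⟨ ℚᵘ.∣-∣-cong (ℚ.toℚᵘ-homo-+ x (ℚ.- y)) ⟩
    ℚᵘ.∣ toℚᵘ x ℚᵘ.+ toℚᵘ (ℚ.- y) ∣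
      ≃⟨ ℚᵘ.∣-∣-cong (ℚᵘ.+-cong (ℚ.toℚᵘ-fromℚᵘ (mkℚᵘ (+ o) T))
           (ℚᵘ.≃-trans (ℚ.toℚᵘ-homo‿- y) (ℚᵘ.-‿cong (ℚ.toℚᵘ-fromℚᵘ (mkℚᵘ (+ N) D))))) ⟩
    ℚᵘ.∣ mkℚᵘ (+ o) T ℚᵘ.- mkℚᵘ (+ N) D ∣
      <⟨ ℚᵘ.*<* numerators ⟩
    mkℚᵘ +[1+ p ] q ∎)
    where
    open ℚᵘ.≤-Reasoning
    x = + o ℚ./ suc T
    y = + N ℚ./ suc D
    difference : + o ℤ.* + suc D ℤ.+ (ℤ.- (+ N)) ℤ.* + suc T ≡ (o * suc D) ⊖ (N * suc T)
    difference = trans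
      (cong₂ ℤ._+_ (sym (ℤ.pos-* o (suc D)))
        (trans (sym (ℤ.neg-distribˡ-* (+ N) (+ suc T))) (cong ℤ.-_ (sym (ℤ.pos-* N (suc T))))))
      (ℤ.m-n≡m⊖n (o * suc D) (N * suc T))
    numerators : + ℤ.∣ + o ℤ.* + suc D ℤ.+ (ℤ.- (+ N)) ℤ.* + suc T ∣ ℤ.* + suc q
                 ℤ.< +[1+ p ] ℤ.* + (suc T * suc D)
    numerators rewrite difference | sym (ℤ.pos-* ℤ.∣ (o * suc D) ⊖ (N * suc T) ∣ (suc q)) =
      ℤ.+<+ (<-≤-trans (∣⊖∣*-< (o * suc D) (N * suc T) o<N N<o) (m≤n*m (suc T * suc D) (suc p)))

  density≡ : ∀ (σ : Perm k) (π : Perm n) {c} → length (subsets n k) ≡ suc c →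
    density σ π ≡ + occurrences σ π ℚ./ suc c
  density≡ σ π eq rewrite eq = refl

  -- Blocks, word and weights enter through equations, so that the limit can be stated on the
  -- literal lists of a design.
  density-inflation-converges : ∀ (σ : Perm k) (τ : Perm n) (↗ : Fin n → Bool) {bs w N D} →
    blocks τ ↗ ≡ bs → word σ ≡ w →
    ∑multisets k bs (indicator ∘ matches w) ≡ N → ∑multisets k bs (const 1) ≡ suc D →
    ConvergesTo (λ m → density σ (inflation τ ↗ m)) (+ N ℚ./ suc D)
  density-inflation-converges {k} {n} σ τ ↗ {N = N} {D} refl refl matches≡N total≡D ε 0<ε =
    -- The summand `k` pays for the passage to r = m - k; what remains is the threshold that `r` has
    -- to exceed.
    suc (c * N * ℚ.↧ₙ ε) + k , close
    where
    c = shiftConst k k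
    close : ∀ m → suc (c * N * ℚ.↧ₙ ε) + k ≤ m →
      ℚ.∣ density σ (inflation τ ↗ m) ℚ.- + N ℚ./ suc D ∣ ℚ.< ε
    close m M≤m = close′ (length (subsets (n * m) k)) refl
      where
      r = m ∸ k

      r-large : c * N * ℚ.↧ₙ ε < r
      r-large = m+n≤o⇒m≤o∸n (suc (c * N * ℚ.↧ₙ ε)) M≤m

      m≡r+k : m ≡ r + k
      m≡r+k = sym (m∸n+n≡m (≤-trans (m≤n+m k _) M≤m))

      instance
        r≢0 : NonZero r
        r≢0 = >-nonZero (≤-<-trans z≤n r-large)
        r^k≢0 : NonZero (r ^ k)
        r^k≢0 = m^n≢0 r k

      m^k/r^k : r * m ^ k ≤ r ^ k * (r + c)
      m^k/r^k = subst (λ x → r * x ^ k ≤ r ^ k * (r + c)) (sym m≡r+k) (n*[n+c]^k≤n^k*[n+shiftConst] r k k)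

      occurrences-lower : r ^ k * N ≤ k ! * occurrences σ (inflation τ ↗ m)
      occurrences-lower = subst₂ (λ x y → r ^ k * x ≤ k ! * y) matches≡N
        (sym (occurrences-inflation σ τ ↗ m)) (∑sublists-blowUp-lower m k k (blocks τ ↗) _ ≤-refl)

      occurrences-upper : k ! * occurrences σ (inflation τ ↗ m) ≤ m ^ k * N
      occurrences-upper = subst₂ (λ x y → k ! * y ≤ m ^ k * x) matches≡N
        (sym (occurrences-inflation σ τ ↗ m)) (∑sublists-blowUp-upper m k (blocks τ ↗) _)

      total-lower : r ^ k * suc D ≤ k ! * length (subsets (n * m) k)
      total-lower = subst₂ (λ x y → r ^ k * x ≤ k ! * y) total≡D
        (sym (length-subsets-inflation k τ ↗ m)) (∑sublists-blowUp-lower m k k (blocks τ ↗) (const 1) ≤-refl)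

      total-upper : k ! * length (subsets (n * m) k) ≤ m ^ k * suc D
      total-upper = subst₂ (λ x y → k ! * y ≤ m ^ k * x) total≡D
        (sym (length-subsets-inflation k τ ↗ m)) (∑sublists-blowUp-upper m k (blocks τ ↗) (const 1))

      close′ : ∀ t → length (subsets (n * m) k) ≡ t →
        ℚ.∣ density σ (inflation τ ↗ m) ℚ.- + N ℚ./ suc D ∣ ℚ.< ε
      -- The case where `density` is 0 by convention cannot occur: the positive number
      -- `r ^ k * suc D` bounds `k !` times the number of subsets from below.
      close′ zero    eq = contradiction
        (subst (λ t → r ^ k * suc D ≤ k ! * t) eq total-lower)
        (<⇒≱ (≤-<-trans (≤-reflexive (*-zeroʳ (k !))) (>-nonZero⁻¹ (r ^ k * suc D) {{m*n≢0 (r ^ k) (suc D)}})))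
      close′ (suc T) eq = subst (λ d → ℚ.∣ d ℚ.- + N ℚ./ suc D ∣ ℚ.< ε)
        (sym (density≡ σ (inflation τ ↗ m) eq))
        (fractions-close (occurrences σ (inflation τ ↗ m)) T N D ε 0<ε
          (o*D-close m^k/r^k r-large (k !) _ (suc T) occurrences-lower occurrences-upper lower upper)
          (N*T-close m^k/r^k r-large (k !) _ (suc T) occurrences-lower occurrences-upper lower upper))
        where
        lower = subst (λ t → r ^ k * suc D ≤ k ! * t) eq total-lower
        upper = subst (λ t → k ! * t ≤ m ^ k * suc D) eq total-upper

  limit-unique : ∀ a {L M} → ConvergesTo a L → ConvergesTo a M → L ≡ M
  limit-unique a {L} {M} a→L a→M with L ℚ.≟ M
  ... | yes L≡M = L≡M
  ... | no  L≢M = contradiction close (ℚ.<-irrefl refl)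
    where
    δ : ℚ
    δ = ℚ.∣ L ℚ.- M ∣ ℚ.* ℚ.½

    L-M≢0 : L ℚ.- M ≢ 0ℚ
    L-M≢0 = L≢M ∘ x∙y⁻¹≈ε⇒x≈y L M

    ∣L-M∣-pos : ℚ.Positive ℚ.∣ L ℚ.- M ∣
    ∣L-M∣-pos = ℚ.nonNeg∧nonZero⇒pos ℚ.∣ L ℚ.- M ∣
      {{ℚ.nonNegative (ℚ.0≤∣p∣ (L ℚ.- M))}} {{ℚ.≢-nonZero (L-M≢0 ∘ ℚ.∣p∣≡0⇒p≡0 (L ℚ.- M))}}

    0<δ : 0ℚ ℚ.< δ
    0<δ = ℚ.positive⁻¹ δ {{ℚ.pos*pos⇒pos ℚ.∣ L ℚ.- M ∣ {{∣L-M∣-pos}} ℚ.½}}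

    δ+δ : δ ℚ.+ δ ≡ ℚ.∣ L ℚ.- M ∣
    δ+δ = trans (sym (ℚ.*-distribˡ-+ ℚ.∣ L ℚ.- M ∣ ℚ.½ ℚ.½)) (ℚ.*-identityʳ ℚ.∣ L ℚ.- M ∣)

    N = proj₁ (a→L δ 0<δ) ⊔ proj₁ (a→M δ 0<δ)
    aN-L = proj₂ (a→L δ 0<δ) N (m≤m⊔n _ _)
    aN-M = proj₂ (a→M δ 0<δ) N (m≤n⊔m (proj₁ (a→L δ 0<δ)) _)

    close : ℚ.∣ L ℚ.- M ∣ ℚ.< ℚ.∣ L ℚ.- M ∣
    close = begin-strict
      ℚ.∣ L ℚ.- M ∣                                   ≡⟨ cong ℚ.∣_∣ telescope ⟩
      ℚ.∣ (a N ℚ.- M) ℚ.- (a N ℚ.- L) ∣               ≤⟨ ℚ.∣p-q∣≤∣p∣+∣q∣ (a N ℚ.- M) (a N ℚ.- L) ⟩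
      ℚ.∣ a N ℚ.- M ∣ ℚ.+ ℚ.∣ a N ℚ.- L ∣             <⟨ ℚ.+-mono-< aN-M aN-L ⟩
      δ ℚ.+ δ                                         ≡⟨ δ+δ ⟩
      ℚ.∣ L ℚ.- M ∣                                   ∎
      where
      open ℚ.≤-Reasoning
      open ℚ-Solver
      telescope : L ℚ.- M ≡ (a N ℚ.- M) ℚ.- (a N ℚ.- L)
      telescope = solve 3 (λ x L M → L :- M := (x :- M) :- (x :- L)) refl (a N) L M

open Inflation
open import Data.Integer using (_+_; _-_)

-- Balanced designs

↗_ ↘_ : ℕ → Block
↗ v = v , true
↘ v = v , false

infix 9 ↗_ ↘_

-- The value is taken mod n only to make the function total; Valid rules out wrapping.
index : ∀ {n} → Vec Block (suc n) → Fin (suc n) → Fin (suc n)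
index {n} bs i = pred (proj₁ (lookup bs i)) mod suc n

-- A pattern is coded by its one-line notation read as a decimal number.
letters : ℕ → List ℕ
letters p = p / 1000 ∷ p / 100 % 10 ∷ p / 10 % 10 ∷ p % 10 ∷ []

record Design : Set where
  constructor design
  field
    {size-1} : ℕ
    base     : Vec Block (suc size-1)
    patterns : List ℕ

  size : ℕ
  size = suc size-1

open Design

weight : ∀ k → Design → List ℕ → ℕ
weight k d w = ∑multisets k (toList (base d)) (indicator ∘ matches w)

-- All fields are decidable statements about numbers. The totals are instances of the multinomial
-- theorem, checked by evaluation for each design. The preimages in `surjective` become the inverse
-- permutation.
record Valid (d : Design) : Set where
  constructor valid
  field
    values     : ∀ i → suc (toℕ (index (base d) i)) ≡ proj₁ (lookup (base d) i)
    surjective : ∀ j → ∃ λ i → index (base d) i ≡ j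
    injective  : ∀ i j → index (base d) i ≡ index (base d) j → i ≡ j
    total₃     : ∑multisets 3 (toList (base d)) (const 1) ≡ size d ^ 3
    total₄     : ∑multisets 4 (toList (base d)) (const 1) ≡ size d ^ 4
    biased     : 6 * weight 3 d (1 ∷ 2 ∷ 3 ∷ []) ≢ size d ^ 3
    balanced   : All (λ p → 24 * weight 4 d (letters p) ≡ size d ^ 4) (patterns d)

valid? : Decidable Valid
valid? d = map′ (λ (v , s , i , t₃ , t₄ , b , e) → valid v s i t₃ t₄ b e)
  (λ (valid v s i t₃ t₄ b e) → v , s , i , t₃ , t₄ , b , e)
  (all? (λ _ → _ ℕ.≟ _)
    ×-dec all? (λ j → any? (λ i → index (base d) i ≟ j))
    ×-dec all? (λ i → all? (λ j → (index (base d) i ≟ index (base d) j) →-dec (i ≟ j)))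
    ×-dec (_ ℕ.≟ _) ×-dec (_ ℕ.≟ _) ×-dec ¬? (_ ℕ.≟ _)
    ×-dec All.all? (λ _ → _ ℕ.≟ _) (patterns d))

tabulate-lookup : ∀ {A : Set} {n} (xs : Vec A n) → tabulate (lookup xs) ≡ toList xs
tabulate-lookup []       = refl
tabulate-lookup (x ∷ xs) = cong (x ∷_) (tabulate-lookup xs)

f*n≡d⇒n/d≡1/f : ∀ n d f → suc f * n ≡ suc d → + n ℚ./ suc d ≡ + 1 ℚ./ suc f
f*n≡d⇒n/d≡1/f n d f f*n≡d = ℚ.fromℚᵘ-cong {mkℚᵘ (+ n) d} {mkℚᵘ (+ 1) f}
  (*≡* (trans (sym (ℤ.pos-* n (suc f)))
    (trans (cong +_ (trans (ℕ.*-comm n (suc f)) f*n≡d)) (sym (ℤ.*-identityˡ (+ suc d))))))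

n/d≡1/f⇒f*n≡d : ∀ n d f → + n ℚ./ suc d ≡ + 1 ℚ./ suc f → suc f * n ≡ suc d
n/d≡1/f⇒f*n≡d n d f n/d≡1/f with *≡* eq ← ℚ.fromℚᵘ-injective {mkℚᵘ (+ n) d} {mkℚᵘ (+ 1) f} n/d≡1/f =
  trans (ℕ.*-comm (suc f) n)
    (ℤ.+-injective (trans (ℤ.pos-* n (suc f)) (trans eq (ℤ.*-identityˡ (+ suc d)))))

module _ {d : Design} (v : Valid d) where
  open Valid v

  basePerm : Perm (size d)
  basePerm = permutation (index (base d)) (proj₁ ∘ surjective) (proj₂ ∘ surjective)
    (λ i → injective _ i (proj₂ (surjective (index (base d) i))))

  orientation : Fin (size d) → Bool
  orientation i = proj₂ (lookup (base d) i)

  blocks-basePerm : blocks basePerm orientation ≡ toList (base d)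
  blocks-basePerm = trans (List.tabulate-cong (λ i → cong (_, orientation i) (values i))) (tabulate-lookup (base d))

  sequence : ∀ m → Perm (size d * m)
  sequence = inflation basePerm orientation

  sizes-tend-to-∞ : TendsToInfinity (size d *_)
  sizes-tend-to-∞ B = B , λ m B≤m → ℕ.≤-trans B≤m (ℕ.m≤n*m m (size d))

  size^≡suc : ∀ k → size d ^ k ≡ suc (pred (size d ^ k))
  size^≡suc k = sym (ℕ.suc-pred (size d ^ k) {{ℕ.m^n≢0 (size d) k}})

  balanced-quasirandom : ∀ (σ : Perm 4) {p} → p ∈ patterns d → word σ ≡ letters p →
    DensityQuasirandom (size d *_) sequence (4 , σ)
  balanced-quasirandom σ {p} p∈ps σ≡p = subst (ConvergesTo (λ m → density σ (sequence m)))
    -- Denominators are given by their predecessors: 23 stands for 4! = 24, and 5 below for 3! = 6.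
    (f*n≡d⇒n/d≡1/f (weight 4 d (letters p)) (pred (size d ^ 4)) 23 (trans (All.lookup balanced p∈ps) (size^≡suc 4)))
    (density-inflation-converges σ basePerm orientation
      blocks-basePerm σ≡p refl (trans total₄ (size^≡suc 4)))

  -- On three points `id` is the pattern 123. Were its limit density 1/6, uniqueness of limits would
  -- equate 1/6 with weight/n³, against `biased`.
  not-quasirandom : ¬ DensityQuasirandom (size d *_) sequence (3 , id)
  not-quasirandom quasirandom = biased (trans
    (n/d≡1/f⇒f*n≡d (weight 3 d (1 ∷ 2 ∷ 3 ∷ [])) (pred (size d ^ 3)) 5
      (limit-unique (λ m → density {3} id (sequence m))
        (density-inflation-converges {3} id basePerm orientation
          blocks-basePerm refl refl (trans total₃ (size^≡suc 3)))
        quasirandom))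
    (sym (size^≡suc 3)))

-- Finite case analysis on four-point patterns.

-- One-line notation as a vector, a type that can be searched exhaustively; being a permutation
-- becomes the decidable condition `Unique`.
Pattern : Set
Pattern = Vec (Fin 4) 4

pattern-of : Perm 4 → Pattern
pattern-of σ = Vec.tabulate (σ ⟨$⟩ʳ_)

code : Pattern → ℕ
code = Vec.foldl (λ _ → ℕ) (λ p d → 10 * p ℕ.+ suc (toℕ d)) 0

allVec? : ∀ {m n} {P : Vec (Fin m) n → Set} → Decidable P → Dec (∀ v → P v)
allVec? {n = zero}  P? = map′ (λ { p [] → p }) (λ p → p []) (P? [])
allVec? {n = suc n} P? = map′ (λ { p (x ∷ xs) → p x xs }) (λ p x xs → p (x ∷ xs))
  (all? λ x → allVec? λ xs → P? (x ∷ xs))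

letters-code : ∀ v → toList (Vec.map (suc ∘ toℕ) v) ≡ letters (code v)
letters-code = toWitness {a? = allVec? λ v → List.≡-dec ℕ._≟_ _ _} _

word≡letters : ∀ σ → word σ ≡ letters (code (pattern-of σ))
word≡letters σ = letters-code (pattern-of σ)

δ : Fin 4 → Fin 4 → ℤ
δ a j = if toℕ a ≡ᵇ toℕ j then + 1 else + 0

permMatrix≡δ : ∀ (π : Perm 4) i j → permMatrix π i j ≡ δ (π ⟨$⟩ʳ i) j
permMatrix≡δ π i j with toℕ (π ⟨$⟩ʳ i) ≡ᵇ toℕ j
... | true  = refl
... | false = refl

-- `Fin 2` is used as a Boolean over which `any?` and `allVec?` can range.
choose : Fin 2 → Fin 4 → Fin 4 → Fin 4
choose zero    a b = a
choose (suc _) a b = b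

-- Abstract, since unfolding the decision procedure on open terms is very slow.
abstract
  δ-sum : ∀ a b c d → (∀ j → δ a j ℤ.+ δ b j ℤ.- δ c j ℤ.- δ d j ≡ + 0) →
    ∃ λ s → c ≡ choose s a b × d ≡ choose s b a
  δ-sum = toWitness {a? = all? λ a → all? λ b → all? λ c → all? λ d →
    all? (λ j → _ ℤ.≟ _) →-dec any? (λ s → (c ≟ choose s a b) ×-dec (d ≟ choose s b a))} _

-- The vector `s` records, position by position, which of the two patterns supplies the value. If π₃
-- is `mix s a b`, then π₄ takes the other values and is `mix s b a`.
mix : Vec (Fin 2) 4 → Pattern → Pattern → Pattern
mix s a b = Vec.zipWith (λ s f → f s) s (Vec.zipWith (λ a b s → choose s a b) a b)

Covers : Pattern → Pattern → Pattern → Pattern → Design → Set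
Covers a b c d e = code a ∈ patterns e × code b ∈ patterns e × code c ∈ patterns e × code d ∈ patterns e

covers? : ∀ a b c d → Decidable (Covers a b c d)
covers? a b c d e =
  (code a ∈? patterns e) ×-dec (code b ∈? patterns e) ×-dec (code c ∈? patterns e) ×-dec (code d ∈? patterns e)

unique? : Decidable (Unique {A = Fin 4} {4})
unique? = allPairs? (λ a b → ¬? (a ≟ b))

perm-unique : ∀ σ → Unique (pattern-of σ)
perm-unique σ = tabulate⁺ (perm-injective σ ∘ cong toℕ)

not-forcing : ∀ {ds π₁ π₂ π₃ π₄} → All Valid ds →
  Any (Covers (pattern-of π₁) (pattern-of π₂) (pattern-of π₃) (pattern-of π₄)) ds →
  ¬ QuasirandomForcing ((4 , π₁) ∷ (4 , π₂) ∷ (4 , π₃) ∷ (4 , π₄) ∷ [])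
not-forcing {π₁ = π₁} {π₂} {π₃} {π₄} (v ∷ _) (here {x = d} (c₁ , c₂ , c₃ , c₄)) forcing =
  not-quasirandom v
    (forcing (size d *_) (sequence v) (sizes-tend-to-∞ v)
      (quasirandom π₁ c₁ ∷ quasirandom π₂ c₂ ∷ quasirandom π₃ c₃ ∷ quasirandom π₄ c₄ ∷ [])
      (3 , id))
  where
  quasirandom : ∀ σ → code (pattern-of σ) ∈ patterns d → DensityQuasirandom (size d *_) (sequence v) (4 , σ)
  quasirandom σ c = balanced-quasirandom v σ c (word≡letters σ)
not-forcing {π₁ = π₁} {π₂} {π₃} {π₄} (_ ∷ vs) (there cs) = not-forcing {π₁ = π₁} {π₂} {π₃} {π₄} vs cs

-- Found by computer search.
designs : List Design
designs =
  design (↗ 12 ∷ ↗ 1 ∷ ↗ 3 ∷ ↘ 7 ∷ ↘ 6 ∷ ↘ 9 ∷ ↘ 8 ∷ ↗ 4 ∷ ↗ 5 ∷ ↗ 10 ∷ ↗ 2 ∷ ↗ 11 ∷ [])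
    (1243 ∷ 1342 ∷ 1432 ∷ 2134 ∷ 2314 ∷ 3214 ∷ 4132 ∷ 4213 ∷ 4231 ∷ []) ∷
  design (↘ 1 ∷ ↘ 12 ∷ ↘ 10 ∷ ↗ 6 ∷ ↗ 7 ∷ ↗ 4 ∷ ↗ 5 ∷ ↘ 9 ∷ ↘ 8 ∷ ↘ 3 ∷ ↘ 11 ∷ ↘ 2 ∷ [])
    (1324 ∷ 1342 ∷ 1423 ∷ 2341 ∷ 3241 ∷ 3421 ∷ 4123 ∷ 4213 ∷ 4312 ∷ []) ∷
  design (↘ 6 ∷ ↘ 7 ∷ ↘ 8 ∷ ↘ 12 ∷ ↘ 5 ∷ ↘ 1 ∷ ↘ 2 ∷ ↘ 3 ∷ ↗ 11 ∷ ↗ 10 ∷ ↗ 9 ∷ ↘ 4 ∷ [])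
    (1432 ∷ 2314 ∷ 2341 ∷ 2413 ∷ 2431 ∷ 3124 ∷ 3142 ∷ 4123 ∷ 4132 ∷ []) ∷
  design (↗ 9 ∷ ↘ 5 ∷ ↘ 4 ∷ ↗ 12 ∷ ↗ 1 ∷ ↗ 6 ∷ ↗ 7 ∷ ↘ 11 ∷ ↘ 10 ∷ ↗ 3 ∷ ↗ 2 ∷ ↗ 8 ∷ [])
    (1432 ∷ 2413 ∷ 3142 ∷ 3214 ∷ 3421 ∷ 4312 ∷ 4321 ∷ []) ∷
  design (↘ 4 ∷ ↗ 9 ∷ ↘ 7 ∷ ↘ 1 ∷ ↗ 12 ∷ ↘ 8 ∷ ↘ 3 ∷ ↘ 6 ∷ ↗ 2 ∷ ↗ 10 ∷ ↗ 11 ∷ ↗ 5 ∷ [])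
    (2314 ∷ 3124 ∷ 3412 ∷ 3421 ∷ 4312 ∷ 4321 ∷ []) ∷
  design (↘ 6 ∷ ↘ 5 ∷ ↗ 11 ∷ ↗ 10 ∷ ↘ 2 ∷ ↘ 1 ∷ ↗ 8 ∷ ↗ 7 ∷ ↗ 9 ∷ ↗ 4 ∷ ↗ 3 ∷ ↗ 12 ∷ [])
    (1324 ∷ 2143 ∷ 2431 ∷ 3421 ∷ 4132 ∷ 4312 ∷ []) ∷
  design (↘ 4 ∷ ↗ 8 ∷ ↗ 9 ∷ ↘ 1 ∷ ↘ 12 ∷ ↘ 7 ∷ ↘ 6 ∷ ↗ 2 ∷ ↗ 3 ∷ ↘ 10 ∷ ↘ 11 ∷ ↘ 5 ∷ [])
    (1234 ∷ 1243 ∷ 2134 ∷ 2341 ∷ 2413 ∷ 3142 ∷ 4123 ∷ []) ∷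
  design (↗ 6 ∷ ↘ 11 ∷ ↗ 8 ∷ ↘ 1 ∷ ↘ 9 ∷ ↘ 5 ∷ ↗ 7 ∷ ↗ 10 ∷ ↘ 4 ∷ ↘ 12 ∷ ↗ 3 ∷ ↗ 2 ∷ [])
    (1234 ∷ 1432 ∷ 2431 ∷ 3214 ∷ 3412 ∷ 4132 ∷ []) ∷
  design (↗ 8 ∷ ↘ 2 ∷ ↘ 3 ∷ ↗ 9 ∷ ↗ 12 ∷ ↘ 7 ∷ ↘ 6 ∷ ↗ 1 ∷ ↗ 4 ∷ ↘ 10 ∷ ↘ 11 ∷ ↗ 5 ∷ [])
    (1324 ∷ 1342 ∷ 1423 ∷ 2314 ∷ 2413 ∷ 3124 ∷ 3142 ∷ []) ∷
  design (↘ 5 ∷ ↗ 11 ∷ ↗ 10 ∷ ↘ 4 ∷ ↘ 1 ∷ ↗ 6 ∷ ↗ 7 ∷ ↘ 12 ∷ ↘ 9 ∷ ↗ 3 ∷ ↗ 2 ∷ ↘ 8 ∷ [])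
    (2413 ∷ 2431 ∷ 3142 ∷ 3241 ∷ 4132 ∷ 4213 ∷ 4231 ∷ []) ∷
  design (↗ 2 ∷ ↗ 9 ∷ ↗ 10 ∷ ↗ 11 ∷ ↘ 4 ∷ ↘ 3 ∷ ↘ 6 ∷ ↘ 5 ∷ ↘ 8 ∷ ↘ 7 ∷ ↗ 12 ∷ ↗ 1 ∷ [])
    (1423 ∷ 2431 ∷ 3124 ∷ 3241 ∷ 4132 ∷ 4213 ∷ 4231 ∷ 4321 ∷ []) ∷
  design (↘ 2 ∷ ↘ 3 ∷ ↗ 12 ∷ ↗ 4 ∷ ↘ 10 ∷ ↘ 7 ∷ ↗ 5 ∷ ↗ 9 ∷ ↗ 1 ∷ ↘ 8 ∷ ↗ 11 ∷ ↘ 6 ∷ [])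
    (1342 ∷ 2143 ∷ 2314 ∷ 2341 ∷ 4123 ∷ 4321 ∷ []) ∷
  design (↘ 1 ∷ ↘ 12 ∷ ↗ 7 ∷ ↗ 8 ∷ ↗ 5 ∷ ↗ 6 ∷ ↗ 3 ∷ ↗ 4 ∷ ↘ 11 ∷ ↘ 10 ∷ ↘ 9 ∷ ↘ 2 ∷ [])
    (1234 ∷ 1324 ∷ 1342 ∷ 1423 ∷ 2314 ∷ 3124 ∷ 3241 ∷ 4213 ∷ []) ∷
  design (↘ 1 ∷ ↗ 11 ∷ ↗ 12 ∷ ↗ 6 ∷ ↘ 5 ∷ ↗ 4 ∷ ↗ 2 ∷ ↗ 10 ∷ ↘ 7 ∷ ↗ 9 ∷ ↗ 3 ∷ ↘ 8 ∷ [])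
    (1234 ∷ 1324 ∷ 4231 ∷ 4312 ∷ 4321 ∷ []) ∷
  design (↗ 8 ∷ ↘ 10 ∷ ↗ 6 ∷ ↗ 4 ∷ ↘ 5 ∷ ↗ 1 ∷ ↗ 7 ∷ ↗ 11 ∷ ↗ 3 ∷ ↗ 2 ∷ ↘ 9 ∷ ↘ 12 ∷ [])
    (2341 ∷ 3412 ∷ 4123 ∷ 4231 ∷ []) ∷
  design (↘ 5 ∷ ↗ 8 ∷ ↗ 1 ∷ ↘ 9 ∷ ↗ 11 ∷ ↗ 7 ∷ ↘ 3 ∷ ↘ 12 ∷ ↘ 4 ∷ ↘ 6 ∷ ↘ 2 ∷ ↗ 10 ∷ [])
    (1243 ∷ 1324 ∷ 2134 ∷ 2413 ∷ 3142 ∷ 3412 ∷ []) ∷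
  design (↗ 12 ∷ ↘ 5 ∷ ↘ 4 ∷ ↗ 1 ∷ ↗ 2 ∷ ↗ 6 ∷ ↗ 7 ∷ ↘ 11 ∷ ↘ 10 ∷ ↗ 3 ∷ ↗ 8 ∷ ↗ 9 ∷ [])
    (1423 ∷ 1432 ∷ 2143 ∷ 3124 ∷ 3214 ∷ []) ∷
  design (↗ 9 ∷ ↘ 4 ∷ ↗ 6 ∷ ↗ 12 ∷ ↘ 1 ∷ ↗ 5 ∷ ↗ 10 ∷ ↗ 7 ∷ ↘ 11 ∷ ↘ 3 ∷ ↘ 2 ∷ ↘ 8 ∷ [])
    (1234 ∷ 1243 ∷ 2134 ∷ 2143 ∷ 2431 ∷ 3241 ∷ []) ∷
  design (↘ 9 ∷ ↘ 3 ∷ ↘ 2 ∷ ↘ 4 ∷ ↗ 5 ∷ ↘ 10 ∷ ↘ 11 ∷ ↘ 12 ∷ ↘ 1 ∷ ↘ 6 ∷ ↘ 7 ∷ ↘ 8 ∷ [])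
    (1342 ∷ 1423 ∷ 2413 ∷ 3142 ∷ 3241 ∷ 3412 ∷ 4213 ∷ []) ∷
  design (↗ 12 ∷ ↗ 2 ∷ ↘ 8 ∷ ↘ 9 ∷ ↘ 10 ∷ ↗ 7 ∷ ↘ 3 ∷ ↘ 5 ∷ ↘ 4 ∷ ↘ 6 ∷ ↗ 11 ∷ ↗ 1 ∷ [])
    (1324 ∷ 1432 ∷ 2431 ∷ 3214 ∷ 3241 ∷ []) ∷
  design (↗ 6 ∷ ↘ 10 ∷ ↗ 1 ∷ ↘ 9 ∷ ↘ 5 ∷ ↘ 4 ∷ ↗ 11 ∷ ↗ 12 ∷ ↘ 2 ∷ ↗ 7 ∷ ↘ 8 ∷ ↗ 3 ∷ [])
    (1423 ∷ 1432 ∷ 4123 ∷ 4132 ∷ []) ∷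
  design (↗ 5 ∷ ↘ 11 ∷ ↗ 10 ∷ ↘ 9 ∷ ↗ 1 ∷ ↗ 2 ∷ ↘ 4 ∷ ↘ 3 ∷ ↗ 12 ∷ ↘ 8 ∷ ↘ 6 ∷ ↗ 7 ∷ [])
    (2143 ∷ 2413 ∷ 3142 ∷ 3412 ∷ []) ∷
  design (↘ 10 ∷ ↗ 4 ∷ ↘ 1 ∷ ↗ 7 ∷ ↗ 8 ∷ ↘ 12 ∷ ↘ 3 ∷ ↗ 2 ∷ ↗ 9 ∷ ↗ 11 ∷ ↘ 6 ∷ ↘ 5 ∷ [])
    (3124 ∷ 3214 ∷ 4123 ∷ 4213 ∷ []) ∷
  design (↗ 5 ∷ ↘ 6 ∷ ↗ 10 ∷ ↘ 11 ∷ ↘ 2 ∷ ↗ 1 ∷ ↗ 9 ∷ ↘ 7 ∷ ↘ 3 ∷ ↘ 12 ∷ ↘ 4 ∷ ↗ 8 ∷ [])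
    (2134 ∷ 2431 ∷ 3124 ∷ 3421 ∷ []) ∷
  design (↘ 7 ∷ ↗ 8 ∷ ↗ 4 ∷ ↗ 2 ∷ ↘ 12 ∷ ↗ 11 ∷ ↗ 5 ∷ ↘ 1 ∷ ↘ 6 ∷ ↘ 10 ∷ ↗ 9 ∷ ↗ 3 ∷ [])
    (1243 ∷ 1423 ∷ 3241 ∷ 3421 ∷ []) ∷
  design (↗ 6 ∷ ↘ 5 ∷ ↘ 9 ∷ ↘ 11 ∷ ↗ 1 ∷ ↘ 2 ∷ ↘ 8 ∷ ↗ 12 ∷ ↗ 7 ∷ ↗ 3 ∷ ↘ 4 ∷ ↘ 10 ∷ [])
    (2134 ∷ 2314 ∷ 4132 ∷ 4312 ∷ []) ∷
  design (↗ 3 ∷ ↘ 9 ∷ ↗ 12 ∷ ↘ 6 ∷ ↘ 5 ∷ ↗ 1 ∷ ↗ 10 ∷ ↘ 11 ∷ ↘ 4 ∷ ↘ 2 ∷ ↗ 7 ∷ ↗ 8 ∷ [])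
    (1342 ∷ 1432 ∷ 2341 ∷ 2431 ∷ []) ∷
  design (↘ 5 ∷ ↘ 12 ∷ ↘ 1 ∷ ↗ 7 ∷ ↗ 6 ∷ ↘ 10 ∷ ↗ 3 ∷ ↘ 11 ∷ ↘ 4 ∷ ↗ 8 ∷ ↘ 2 ∷ ↗ 9 ∷ [])
    (2143 ∷ 3421 ∷ 4213 ∷ 4231 ∷ []) ∷
  design (↘ 8 ∷ ↗ 4 ∷ ↗ 12 ∷ ↗ 3 ∷ ↗ 7 ∷ ↘ 9 ∷ ↘ 1 ∷ ↗ 2 ∷ ↗ 11 ∷ ↘ 10 ∷ ↗ 6 ∷ ↘ 5 ∷ [])
    (1243 ∷ 1342 ∷ 4213 ∷ 4312 ∷ []) ∷
  design (↘ 3 ∷ ↗ 8 ∷ ↘ 7 ∷ ↗ 2 ∷ ↘ 12 ∷ ↘ 11 ∷ ↗ 4 ∷ ↗ 5 ∷ ↗ 9 ∷ ↘ 1 ∷ ↗ 10 ∷ ↘ 6 ∷ [])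
    (2314 ∷ 2341 ∷ 3214 ∷ 3241 ∷ []) ∷
  design (↘ 12 ∷ ↗ 1 ∷ ↗ 8 ∷ ↘ 2 ∷ ↗ 10 ∷ ↗ 4 ∷ ↘ 5 ∷ ↘ 6 ∷ ↗ 7 ∷ ↘ 3 ∷ ↘ 9 ∷ ↗ 11 ∷ [])
    (1243 ∷ 1423 ∷ 2134 ∷ 3124 ∷ 4321 ∷ []) ∷
  design (↘ 2 ∷ ↗ 10 ∷ ↗ 5 ∷ ↘ 12 ∷ ↘ 8 ∷ ↘ 4 ∷ ↘ 9 ∷ ↗ 1 ∷ ↗ 7 ∷ ↘ 6 ∷ ↗ 11 ∷ ↗ 3 ∷ [])
    (1234 ∷ 1423 ∷ 2413 ∷ 3421 ∷ 4231 ∷ []) ∷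
  []

-- The weights are sums over multisets: 1365 of them for four out of twelve entries, against 12⁴ =
-- 20736 words.
designs-valid : All Valid designs
designs-valid = toWitness {a? = All.all? valid? designs} _

-- Exhaustive search over `a`, `b` and `s`. Each uniqueness test stands before the next quantifier,
-- so only 24 of the 256 vectors are pursued for `a` and for `b`. The constant `s` give the
-- degenerate sets with no patterns besides `a` and `b`.
designs-cover : ∀ a → Unique a → ∀ b → Unique b → ∀ s → Unique (mix s a b) →
  Any (Covers a b (mix s a b) (mix s b a)) designs
designs-cover = toWitness {a? = allVec? λ a → unique? a →-dec allVec? λ b → unique? b →-dec
  allVec? λ s → unique? (mix s a b) →-dec Any.any? (covers? a b (mix s a b) (mix s b a)) designs} _

theorem15 : (π₁ π₂ π₃ π₄ : Perm 4) →
    (∀ (i j : Fin 4) →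
    permMatrix π₁ i j + permMatrix π₂ i j - permMatrix π₃ i j - permMatrix π₄ i j ≡ + 0) →
    ¬ QuasirandomForcing ((4 , π₁) ∷ (4 , π₂) ∷ (4 , π₃) ∷ (4 , π₄) ∷ [])
theorem15 π₁ π₂ π₃ π₄ A₁+A₂-A₃-A₄≡0 =
  not-forcing {designs} {π₁} {π₂} {π₃} {π₄} designs-valid covered
  where
  swap : ∀ i → ∃ λ s → π₃ ⟨$⟩ʳ i ≡ choose s (π₁ ⟨$⟩ʳ i) (π₂ ⟨$⟩ʳ i) × π₄ ⟨$⟩ʳ i ≡ choose s (π₂ ⟨$⟩ʳ i) (π₁ ⟨$⟩ʳ i)
  swap i = δ-sum (π₁ ⟨$⟩ʳ i) (π₂ ⟨$⟩ʳ i) (π₃ ⟨$⟩ʳ i) (π₄ ⟨$⟩ʳ i) λ j → trans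
    (sym (cong₂ _-_ (cong₂ _-_ (cong₂ _+_ (permMatrix≡δ π₁ i j) (permMatrix≡δ π₂ i j)) (permMatrix≡δ π₃ i j))
                    (permMatrix≡δ π₄ i j)))
    (A₁+A₂-A₃-A₄≡0 i j)

  s : Vec (Fin 2) 4
  s = Vec.tabulate (proj₁ ∘ swap)

  π₃≡mix : pattern-of π₃ ≡ mix s (pattern-of π₁) (pattern-of π₂)
  -- At the concrete length 4 the nested `zipWith` unfolds to an explicit vector, the tabulation of
  -- `choose` at each position, so pointwise equality is enough.
  π₃≡mix = Vec.tabulate-cong (proj₁ ∘ proj₂ ∘ swap)

  π₄≡mix : pattern-of π₄ ≡ mix s (pattern-of π₂) (pattern-of π₁)
  π₄≡mix = Vec.tabulate-cong (proj₂ ∘ proj₂ ∘ swap)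

  covered : Any (Covers (pattern-of π₁) (pattern-of π₂) (pattern-of π₃) (pattern-of π₄)) designs
  covered = subst₂ (λ c d → Any (Covers (pattern-of π₁) (pattern-of π₂) c d) designs)
    (sym π₃≡mix) (sym π₄≡mix)
    (designs-cover (pattern-of π₁) (perm-unique π₁) (pattern-of π₂) (perm-unique π₂) s
      (subst Unique π₃≡mix (perm-unique π₃)))
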